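{- For $n\ge 2$, the abelianization $A_1^{n-2}(\mathcal{T}_n)^{ab}$ of the $(n-2)$-discrete fundamental group of $\mathcal{T}_n$ is a free abelian group with a minimal generating set of size $\binom{n+2}{4}$.
   Context: Let $P_{n+3}$ be a convex $(n+3)$-gon. $\mathcal{T}_n$ is the simplicial complex whose vertices are the diagonals of $P_{n+3}$ and whose simplices are sets of pairwise non-crossing diagonals; its maximal simplices are the triangulations of $P_{n+3}$ ($n$ diagonals each). Discrete fundamental group: for $q=n-2$, two maximal simplices are $q$-near if they share a $q$-face, i.e. two triangulations are $q$-near iff they are equal or differ by a single diagonal flip. A $q$-loop based at a triangulation $\sigma_0$ is a sequence $\sigma_0,\sigma_1,\dots,\sigma_k=\sigma_0$ with consecutive terms $q$-near. The equivalence $\simeq_A$ on such loops is generated by (1) repeating a term of a loop, and (2) declaring two loops of the same length equivalent if there is a grid between them: a finite sequence of loops of that length, all based at $\sigma_0$, starting at one and ending at the other, with the $i$-th terms of consecutive loops $q$-near for every $i$. The equivalence classes form a group $A_1^{n-2}(\mathcal{T}_n)$ under concatenation (independent of base point up to isomorphism). Equivalently (a known fact), it is isomorphic to $\pi_1(X_\Gamma)$, where $\Gamma$ is the flip graph (nodes: triangulations; edges: single diagonal flips) and $X_\Gamma$ is the 2-complex obtained by attaching a 2-cell along every 3- and 4-cycle of $\Gamma$; thus $A_1^{n-2}(\mathcal{T}_n)^{ab}\cong H_1(X_\Gamma;\mathbb{Z})$. -}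

module Defs where

open import Data.Nat using (ℕ; zero; suc; _+_; _∸_; _<_; _≤_)
open import Data.Integer using (ℤ; +_; -[1+_])
open import Data.Bool using (Bool; true)
open import Data.Fin using (Fin; toℕ)
open import Data.Fin.Properties using ()
open import Data.List using (List; []; _∷_; _++_; length; reverse; foldr)
open import Data.List.Relation.Unary.All using (All)
open import Data.List.Relation.Unary.Linked using (Linked)
open import Data.List.Relation.Unary.Unique.Propositional using (Unique)
open import Data.List.Relation.Binary.Pointwise using (Pointwise)
open import Data.Product using (Σ; _×_; _,_; ∃)
open import Data.Sum using (_⊎_)
open import Data.Empty using (⊥)
open import Relation.Nullary using (¬_)
open import Relation.Binary.PropositionalEquality using (_≡_)

-- The convex polygon P_{n+3}: vertices labelled 0,1,…,n+2 (as Fin (n+3))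
-- in cyclic order.

IsDiag : (n : ℕ) → Fin (n + 3) → Fin (n + 3) → Set
IsDiag n i j = (suc (suc (toℕ i)) ≤ toℕ j) × ¬ ((toℕ i ≡ 0) × (toℕ j ≡ n + 2))

Cross : {m : ℕ} → Fin m → Fin m → Fin m → Fin m → Set
Cross a b c d =
    (toℕ a < toℕ c × toℕ c < toℕ b × toℕ b < toℕ d)
  ⊎ (toℕ c < toℕ a × toℕ a < toℕ d × toℕ d < toℕ b)

-- A maximal simplex of T_n: a set S of diagonals (given by its
-- characteristic function on ordered pairs), pairwise non-crossing,
-- and maximal with this property (every diagonal crossing no member of S
-- belongs to S).  These are exactly the triangulations of P_{n+3}.
record Tri (n : ℕ) : Set where
  field
    S        : Fin (n + 3) → Fin (n + 3) → Bool
    onlyDiag : ∀ i j → S i j ≡ true → IsDiag n i j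
    noCross  : ∀ a b c d → S a b ≡ true → S c d ≡ true → ¬ Cross a b c d
    maximal  : ∀ i j → IsDiag n i j →
               (∀ c d → S c d ≡ true → ¬ Cross i j c d) → S i j ≡ true
open Tri public

TriEq : {n : ℕ} → Tri n → Tri n → Set
TriEq σ τ = ∀ i j → S σ i j ≡ S τ i j

-- q-near for q = n - 2: σ and τ share a q-face, i.e. there are q+1 = n-1
-- distinct diagonals lying in both.
Near : {n : ℕ} → Tri n → Tri n → Set
Near {n} σ τ =
  ∃ λ (F : List (Fin (n + 3) × Fin (n + 3))) →
      (length F ≡ suc (n ∸ 2))
    × Unique F
    × All (λ p → (S σ (Data.Product.proj₁ p) (Data.Product.proj₂ p) ≡ true)
               × (S τ (Data.Product.proj₁ p) (Data.Product.proj₂ p) ≡ true)) F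

HeadIs : {n : ℕ} → Tri n → List (Tri n) → Set
HeadIs σ₀ []      = ⊥
HeadIs σ₀ (x ∷ _) = TriEq x σ₀

LastIs : {n : ℕ} → Tri n → List (Tri n) → Set
LastIs σ₀ []           = ⊥
LastIs σ₀ (x ∷ [])     = TriEq x σ₀
LastIs σ₀ (x ∷ y ∷ xs) = LastIs σ₀ (y ∷ xs)

IsLoop : {n : ℕ} → Tri n → List (Tri n) → Set
IsLoop σ₀ xs = HeadIs σ₀ xs × LastIs σ₀ xs × Linked Near xs

-- The relation ≃_A on q-loops based at σ₀: the equivalence relation
-- generated by (1) repetition of a term and (2) grids (a grid is a chain
-- of same-length loops, consecutive ones termwise q-near; its equivalence
-- closure is generated by single termwise-near steps).

data _≃A_ {n : ℕ} {σ₀ : Tri n} : List (Tri n) → List (Tri n) → Set where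
  repeat : ∀ ys x zs → IsLoop σ₀ (ys ++ x ∷ zs) → IsLoop σ₀ (ys ++ x ∷ x ∷ zs) →
           _≃A_ {σ₀ = σ₀} (ys ++ x ∷ zs) (ys ++ x ∷ x ∷ zs)
  grid   : ∀ xs ys → IsLoop σ₀ xs → IsLoop σ₀ ys → Pointwise Near xs ys →
           _≃A_ {σ₀ = σ₀} xs ys
  refl′  : ∀ xs → IsLoop σ₀ xs → _≃A_ {σ₀ = σ₀} xs xs
  sym′   : ∀ {xs ys} → _≃A_ {σ₀ = σ₀} xs ys → _≃A_ {σ₀ = σ₀} ys xs
  trans′ : ∀ {xs ys zs} → _≃A_ {σ₀ = σ₀} xs ys → _≃A_ {σ₀ = σ₀} ys zs →
           _≃A_ {σ₀ = σ₀} xs zs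

-- Group operations on loops: product = concatenation (the repeated base
-- term is harmless by rule (1)), unit = constant loop, inverse = reversal.
_·_ : {n : ℕ} → List (Tri n) → List (Tri n) → List (Tri n)
xs · ys = xs ++ ys

inv : {n : ℕ} → List (Tri n) → List (Tri n)
inv = reverse

-- Equality in the abelianization A_1^{n-2}(T_n)^{ab} (based at σ₀):
-- the congruence (w.r.t. concatenation) generated by ≃_A together with
-- commutativity.  Its classes are the elements of G / [G,G].
data _≈ab_ {n : ℕ} {σ₀ : Tri n} : List (Tri n) → List (Tri n) → Set where
  base   : ∀ {xs ys} → _≃A_ {σ₀ = σ₀} xs ys → _≈ab_ {σ₀ = σ₀} xs ys
  comm   : ∀ xs ys → IsLoop σ₀ xs → IsLoop σ₀ ys →
           _≈ab_ {σ₀ = σ₀} (xs · ys) (ys · xs)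
  cong·  : ∀ {xs xs′ ys ys′} → _≈ab_ {σ₀ = σ₀} xs xs′ → _≈ab_ {σ₀ = σ₀} ys ys′ →
           _≈ab_ {σ₀ = σ₀} (xs · ys) (xs′ · ys′)
  sym′   : ∀ {xs ys} → _≈ab_ {σ₀ = σ₀} xs ys → _≈ab_ {σ₀ = σ₀} ys xs
  trans′ : ∀ {xs ys zs} → _≈ab_ {σ₀ = σ₀} xs ys → _≈ab_ {σ₀ = σ₀} ys zs →
           _≈ab_ {σ₀ = σ₀} xs zs

pow : {n : ℕ} → Tri n → List (Tri n) → ℤ → List (Tri n)
pow σ₀ xs (+ zero)       = σ₀ ∷ []
pow σ₀ xs (+ suc k)      = xs · pow σ₀ xs (+ k)
pow σ₀ xs -[1+ zero ]    = inv xs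
pow σ₀ xs -[1+ suc k ]   = inv xs · pow σ₀ xs -[1+ k ]

lincomb : {n N : ℕ} → Tri n → (Fin N → List (Tri n)) → (Fin N → ℤ) → List (Tri n)
lincomb {N = zero}  σ₀ b c = σ₀ ∷ []
lincomb {N = suc N} σ₀ b c =
  pow σ₀ (b Data.Fin.zero) (c Data.Fin.zero) · lincomb σ₀ (λ i → b (Data.Fin.suc i)) (λ i → c (Data.Fin.suc i))

-- A_1^{n-2}(T_n)^{ab} (based at σ₀) is free abelian with a basis of N elements
-- (equivalently: free abelian with minimal generating set of size N = its rank).
FreeAbelianOfRank : (n : ℕ) → Tri n → ℕ → Set
FreeAbelianOfRank n σ₀ N =
  Σ (Fin N → List (Tri n)) λ b →
      (∀ i → IsLoop σ₀ (b i))
    × (∀ xs → IsLoop σ₀ xs → ∃ λ (c : Fin N → ℤ) → _≈ab_ {σ₀ = σ₀} xs (lincomb σ₀ b c))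
    × (∀ (c d : Fin N → ℤ) → _≈ab_ {σ₀ = σ₀} (lincomb σ₀ b c) (lincomb σ₀ b d) → ∀ i → c i ≡ d i)

{-# OPTIONS --safe #-}
module Submission where

-- A triangulation of the polygon with vertices 0, …, n+2 is a binary tree on the base edge
-- 0,n+2, and the flip bd → ac of a quadrilateral a < b < c < d is the rotation A(BC) → (AB)C.
--
-- Generation.  Flips that add a diagonal at vertex 0 (those with a = 0) lead from every
-- triangulation to the fan at 0, and two of them always commute, so all such paths are
-- homotopic through squares; hence the loop group is generated by the flips with a ≥ 1,
-- joined to the fan by these paths.  Pushing such a flip towards vertex 0 by commuting flips
-- shows that its class depends on a, b, c, d only: the triangulations of the complementary
-- polygons do not matter, because a change inside them commutes with all five flips of the
-- pentagon 0abcd.  This leaves one generator for each 4-subset of {1, …, n+2}.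
--
-- Independence.  For each 4-subset the signed number of flips in abcd along a loop is additive
-- and vanishes on 4-cycles of flips: a neighbour of a triangulation in which abcd can be flipped
-- still contains ac or bd.  It is 1 on the generator of abcd and 0 on the others.

open import Defs
open import Level using (0ℓ)
open import Algebra.Bundles using (AbelianGroup)
import Algebra.Properties.AbelianGroup as AbelianGroupProperties
open import Data.Bool using (true; false)
import Data.Bool.Properties as Bool
open import Data.Empty using (⊥; ⊥-elim)
open import Data.Fin using (Fin; zero; suc; toℕ; fromℕ<)
open import Data.Fin.Properties using (toℕ<n; toℕ-fromℕ<; toℕ-injective)
open import Data.Integer as ℤ using (ℤ; +_; -[1+_])
import Data.Integer.Properties as ℤ
open import Data.List using (List; []; _∷_; _++_; length; lookup; map; reverse)
open import Data.List.Properties using (++-assoc; length-++; length-map; map-++; map-∘; map-cong; map-id; map-id-local; reverse-map; unfold-reverse)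
open import Data.List.Membership.Propositional using (_∈_)
open import Data.List.Membership.Propositional.Properties using (∈-++⁺ˡ; ∈-++⁺ʳ; ∈-++⁻; ∈-map⁺; ∈-map⁻; ∈-lookup)
open import Data.List.Relation.Binary.Pointwise as Pointwise using (Pointwise; []; _∷_)
open import Data.List.Relation.Unary.All as All using (All; []; _∷_)
import Data.List.Relation.Unary.All.Properties as All
open import Data.List.Relation.Unary.AllPairs using ([]; _∷_)
open import Data.List.Relation.Unary.Any using (here; there; index)
open import Data.List.Relation.Unary.Any.Properties using (lookup-index)
open import Data.List.Relation.Unary.Linked using (Linked; []; [-]; _∷_)
open import Data.List.Relation.Unary.Unique.Propositional using (Unique)
import Data.List.Relation.Unary.Unique.Propositional.Properties as Unique
open import Data.Nat using (ℕ; zero; suc; _+_; _∸_; _≤_; _<_; z≤n; s≤s; z<s; _≤?_; _<?_)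
import Data.Nat.Combinatorics as Combinatorics
open import Data.Nat.Properties
open import Data.Product using (Σ; ∃; _×_; _,_; proj₁; proj₂)
open import Data.Product.Properties using (≡-dec; ,-injective; ,-injectiveˡ; ,-injectiveʳ)
open import Data.Sum using (_⊎_; inj₁; inj₂)
open import Data.Vec using (Vec; []; _∷_)
open import Data.Vec.Functional using (updateAt)
open import Data.Vec.Properties using (∷-injectiveʳ)
open import Relation.Binary.Definitions using (Reflexive; Symmetric; tri<; tri≈; tri>)
open import Relation.Binary.PropositionalEquality using (_≡_; _≢_; refl; sym; trans; cong; cong₂; subst; subst₂; module ≡-Reasoning)
import Relation.Binary.Reasoning.Setoid as SetoidReasoning
open import Relation.Nullary using (¬_; Dec; yes; no; does)
open import Relation.Nullary.Decidable using (dec-true; ¬?; _×-dec_; _⊎-dec_)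

-- Triangulations as binary trees

-- A `Tri` is determined only up to `TriEq`, and nearness is a statement about common faces. Trees
-- serve as normal forms with propositional equality; one grid step replaces all terms of a loop by
-- their normal forms, after which homotopies of tree paths suffice.
--
-- The canonical paths to the fan form a spanning tree of the flip graph, so each edge e yields a
-- loop class `h e`. Four of the five flips of the pentagon 0abcd are at vertex 0 and have trivial
-- class; hence the class of the flip in abcd is, up to sign, that of the 5-cycle of this pentagon,
-- a cycle that no 2-cell fills.
--
-- The obstacle is a change inside a polygon on ab, bc or cd: it is not a flip at 0, and its square
-- with the flip in abcd only gives turn · e₂ = e₁ · turn′. The other four flips of the pentagon
-- give e₁ = e₂, and commutativity then allows e₁ to be cancelled.
--
-- The signed count vanishes on 4-cycles because each edge of a 4-cycle has an end next to any given
-- corner. In a 5-cycle the edge opposite to a corner has no such end, and so the pentagon is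
-- detected.

data Tree : ℕ → ℕ → Set where
  leaf : ∀ {i} → Tree i (suc i)
  node : ∀ {i k j} → Tree i k → Tree k j → Tree i j

tree-< : ∀ {i j} → Tree i j → i < j
tree-< leaf       = n<1+n _
tree-< (node A B) = <-trans (tree-< A) (tree-< B)

-- pq is a side or a diagonal of the triangulation; leaves are the sides k,k+1.
data Span (p q : ℕ) : ∀ {i j} → Tree i j → Set where
  here : {t : Tree p q} → Span p q t
  inl  : ∀ {i k j} {A : Tree i k} {B : Tree k j} → Span p q A → Span p q (node A B)
  inr  : ∀ {i k j} {A : Tree i k} {B : Tree k j} → Span p q B → Span p q (node A B)

module _ {p q : ℕ} where

  span-lo : ∀ {i j} {t : Tree i j} → Span p q t → i ≤ p
  span-lo here              = ≤-refl
  span-lo (inl s)           = span-lo s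
  span-lo (inr {A = A} s)   = ≤-trans (<⇒≤ (tree-< A)) (span-lo s)

  span-hi : ∀ {i j} {t : Tree i j} → Span p q t → q ≤ j
  span-hi here              = ≤-refl
  span-hi (inr s)           = span-hi s
  span-hi (inl {B = B} s)   = ≤-trans (span-hi s) (<⇒≤ (tree-< B))

  span-< : ∀ {i j} {t : Tree i j} → Span p q t → p < q
  span-< (here {t})  = tree-< t
  span-< (inl s)     = span-< s
  span-< (inr s)     = span-< s

  span-left : ∀ {i k j} {A : Tree i k} {B : Tree k j} → q ≤ k → Span p q (node A B) → Span p q A
  span-left {B = B} q≤k here = ⊥-elim (<⇒≱ (tree-< B) q≤k)
  span-left q≤k (inl s)      = s
  span-left q≤k (inr s)      = ⊥-elim (<⇒≱ (span-< s) (≤-trans q≤k (span-lo s)))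

  span-right : ∀ {i k j} {A : Tree i k} {B : Tree k j} → k ≤ p → Span p q (node A B) → Span p q B
  span-right {A = A} k≤p here = ⊥-elim (<⇒≱ (tree-< A) k≤p)
  span-right k≤p (inr s)      = s
  span-right k≤p (inl s)      = ⊥-elim (<⇒≱ (span-< s) (≤-trans (span-hi s) k≤p))

  span? : ∀ {i j} (t : Tree i j) → Dec (Span p q t)
  span? {i} {j} t with i ≟ p | j ≟ q
  ... | yes refl | yes refl = yes here
  span? leaf | no i≢p | _ = no λ { here → i≢p refl }
  span? leaf | yes _ | no j≢q = no λ { here → j≢q refl }
  span? (node A B) | no i≢p | _ with span? A | span? B
  ... | yes s | _ = yes (inl s)
  ... | no _ | yes s = yes (inr s)
  ... | no ¬a | no ¬b = no λ { here → i≢p refl ; (inl s) → ¬a s ; (inr s) → ¬b s }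
  span? (node A B) | yes _ | no j≢q with span? A | span? B
  ... | yes s | _ = yes (inl s)
  ... | no _ | yes s = yes (inr s)
  ... | no ¬a | no ¬b = no λ { here → j≢q refl ; (inl s) → ¬a s ; (inr s) → ¬b s }

spans-noncrossing : ∀ {p q r s i j} {t : Tree i j} → Span p q t → Span r s t →
                    p < r → r < q → q < s → ⊥
spans-noncrossing here y p<r r<q q<s = <⇒≱ q<s (span-hi y)
spans-noncrossing x here p<r r<q q<s = <⇒≱ p<r (span-lo x)
spans-noncrossing (inl x) (inl y) p<r r<q q<s = spans-noncrossing x y p<r r<q q<s
spans-noncrossing (inr x) (inr y) p<r r<q q<s = spans-noncrossing x y p<r r<q q<s
spans-noncrossing (inl x) (inr y) p<r r<q q<s =
  <⇒≱ r<q (≤-trans (span-hi x) (span-lo y))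
spans-noncrossing (inr x) (inl y) p<r r<q q<s =
  <⇒≱ (<-trans p<r (span-< y)) (≤-trans (span-hi y) (span-lo x))

-- If the apex k lies strictly between p and q, then ik crosses pq unless p = i, and kj crosses pq
-- unless q = j. Otherwise pq lies on one side of k.
spans-maximal : ∀ {p q i j} (t : Tree i j) → i ≤ p → p < q → q ≤ j →
                (∀ {r s} → Span r s t → r < p → p < s → s < q → ⊥) →
                (∀ {r s} → Span r s t → p < r → r < q → q < s → ⊥) →
                Span p q t
spans-maximal {p} {q} {i} leaf i≤p p<q q≤j _ _
  with ≤-antisym i≤p (≤-pred (≤-trans p<q q≤j)) | ≤-antisym q≤j (≤-trans (s≤s i≤p) p<q)
... | refl | refl = here
spans-maximal {p} {q} {i} {j} (node {k = k} A B) i≤p p<q q≤j ¬l ¬r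
  with q ≤? k | k ≤? p
... | yes q≤k | _ = inl (spans-maximal A i≤p p<q q≤k (λ s → ¬l (inl s)) (λ s → ¬r (inl s)))
... | no _ | yes k≤p = inr (spans-maximal B k≤p p<q q≤j (λ s → ¬l (inr s)) (λ s → ¬r (inr s)))
... | no q≰k | no k≰p with m≤n⇒m<n∨m≡n i≤p | m≤n⇒m<n∨m≡n q≤j
...   | inj₁ i<p | _ = ⊥-elim (¬l (inl (here {t = A})) i<p (≰⇒> k≰p) (≰⇒> q≰k))
...   | inj₂ _ | inj₁ q<j = ⊥-elim (¬r (inr (here {t = B})) (≰⇒> k≰p) (≰⇒> q≰k) q<j)
...   | inj₂ refl | inj₂ refl = here

_⊆_ : ∀ {i j i′ j′} → Tree i j → Tree i′ j′ → Set
t ⊆ t′ = ∀ {p q} → Span p q t → Span p q t′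

-- Different apexes would put two crossing diagonals into t′, so a single inclusion forces equality.
⊆⇒≡ : ∀ {i j} (t t′ : Tree i j) → t ⊆ t′ → t ≡ t′
⊆⇒≡ leaf leaf _ = refl
⊆⇒≡ leaf (node A B) _ = ⊥-elim (<⇒≱ (tree-< A) (≤-pred (tree-< B)))
⊆⇒≡ (node A B) leaf _ = ⊥-elim (<⇒≱ (tree-< A) (≤-pred (tree-< B)))
⊆⇒≡ (node {k = k} A B) (node {k = k′} A′ B′) sub with <-cmp k k′
... | tri< k<k′ _ _ = ⊥-elim (spans-noncrossing (inl (here {t = A′})) (sub (inr (here {t = B})))
                               (tree-< A) k<k′ (tree-< B′))
... | tri> _ _ k′<k = ⊥-elim (spans-noncrossing (sub (inl (here {t = A}))) (inr (here {t = B′}))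
                               (tree-< A′) k′<k (tree-< B))
... | tri≈ _ refl _ = cong₂ node
  (⊆⇒≡ A A′ λ s → span-left (span-hi s) (sub (inl s)))
  (⊆⇒≡ B B′ λ s → span-right (span-lo s) (sub (inr s)))

-- The flip of the quadrilateral a < b < c < d that replaces the diagonal bd by ac.
data Rot (a b c d : ℕ) : ∀ {i j} → Tree i j → Tree i j → Set where
  rot : (A : Tree a b) (B : Tree b c) (C : Tree c d) →
        Rot a b c d (node A (node B C)) (node (node A B) C)
  inl : ∀ {i k j} {A A′ : Tree i k} {B : Tree k j} → Rot a b c d A A′ →
        Rot a b c d (node A B) (node A′ B)
  inr : ∀ {i k j} {A : Tree i k} {B B′ : Tree k j} → Rot a b c d B B′ →
        Rot a b c d (node A B) (node A B′)

data Adj {i j : ℕ} : Tree i j → Tree i j → Set where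
  same : ∀ {t} → Adj t t
  fwd  : ∀ {a b c d t t′} → Rot a b c d t t′ → Adj t t′
  bwd  : ∀ {a b c d t t′} → Rot a b c d t t′ → Adj t′ t

adj-sym : ∀ {i j} {t t′ : Tree i j} → Adj t t′ → Adj t′ t
adj-sym same    = same
adj-sym (fwd r) = bwd r
adj-sym (bwd r) = fwd r

adj-inl : ∀ {i k j} {A A′ : Tree i k} {B : Tree k j} → Adj A A′ → Adj (node A B) (node A′ B)
adj-inl same    = same
adj-inl (fwd r) = fwd (inl r)
adj-inl (bwd r) = bwd (inl r)

adj-inr : ∀ {i k j} {A : Tree i k} {B B′ : Tree k j} → Adj B B′ → Adj (node A B) (node A B′)
adj-inr same    = same
adj-inr (fwd r) = fwd (inr r)
adj-inr (bwd r) = bwd (inr r)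

record Quad (a b c d : ℕ) {i j} (t : Tree i j) : Set where
  field
    ab : Span a b t
    bc : Span b c t
    cd : Span c d t
    ad : Span a d t

module _ {a b c d : ℕ} where

  quad-inl : ∀ {i k j} {A : Tree i k} {B : Tree k j} → Quad a b c d A → Quad a b c d (node A B)
  quad-inl Q = record { ab = inl ab ; bc = inl bc ; cd = inl cd ; ad = inl ad } where open Quad Q

  quad-inr : ∀ {i k j} {A : Tree i k} {B : Tree k j} → Quad a b c d B → Quad a b c d (node A B)
  quad-inr Q = record { ab = inr ab ; bc = inr bc ; cd = inr cd ; ad = inr ad } where open Quad Q

  rot-quad : ∀ {i j} {t t′ : Tree i j} → Rot a b c d t t′ → Quad a b c d t
  rot-quad (rot A B C) = record { ab = inl here ; bc = inr (inl here) ; cd = inr (inr here) ; ad = here }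
  rot-quad (inl r) = quad-inl (rot-quad r)
  rot-quad (inr r) = quad-inr (rot-quad r)

  rot-old : ∀ {i j} {t t′ : Tree i j} → Rot a b c d t t′ → Span b d t
  rot-old (rot A B C) = inr here
  rot-old (inl r)     = inl (rot-old r)
  rot-old (inr r)     = inr (rot-old r)

  rot-new : ∀ {i j} {t t′ : Tree i j} → Rot a b c d t t′ → Span a c t′
  rot-new (rot A B C) = inl here
  rot-new (inl r)     = inl (rot-new r)
  rot-new (inr r)     = inr (rot-new r)

  rot-keeps : ∀ {p q i j} {t t′ : Tree i j} → Rot a b c d t t′ → Span p q t →
              (p ≡ b × q ≡ d) ⊎ Span p q t′
  rot-keeps (rot A B C) here          = inj₂ here
  rot-keeps (rot A B C) (inl s)       = inj₂ (inl (inl s))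
  rot-keeps (rot A B C) (inr here)    = inj₁ (refl , refl)
  rot-keeps (rot A B C) (inr (inl s)) = inj₂ (inl (inr s))
  rot-keeps (rot A B C) (inr (inr s)) = inj₂ (inr s)
  rot-keeps (inl r) here    = inj₂ here
  rot-keeps (inl r) (inl s) with rot-keeps r s
  ... | inj₁ e = inj₁ e
  ... | inj₂ s′ = inj₂ (inl s′)
  rot-keeps (inl r) (inr s) = inj₂ (inr s)
  rot-keeps (inr r) here    = inj₂ here
  rot-keeps (inr r) (inl s) = inj₂ (inl s)
  rot-keeps (inr r) (inr s) with rot-keeps r s
  ... | inj₁ e = inj₁ e
  ... | inj₂ s′ = inj₂ (inr s′)

  rot-keeps⁻ : ∀ {p q i j} {t t′ : Tree i j} → Rot a b c d t t′ → Span p q t′ →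
               (p ≡ a × q ≡ c) ⊎ Span p q t
  rot-keeps⁻ (rot A B C) here          = inj₂ here
  rot-keeps⁻ (rot A B C) (inr s)       = inj₂ (inr (inr s))
  rot-keeps⁻ (rot A B C) (inl here)    = inj₁ (refl , refl)
  rot-keeps⁻ (rot A B C) (inl (inl s)) = inj₂ (inl s)
  rot-keeps⁻ (rot A B C) (inl (inr s)) = inj₂ (inr (inl s))
  rot-keeps⁻ (inl r) here    = inj₂ here
  rot-keeps⁻ (inl r) (inl s) with rot-keeps⁻ r s
  ... | inj₁ e = inj₁ e
  ... | inj₂ s′ = inj₂ (inl s′)
  rot-keeps⁻ (inl r) (inr s) = inj₂ (inr s)
  rot-keeps⁻ (inr r) here    = inj₂ here
  rot-keeps⁻ (inr r) (inl s) = inj₂ (inl s)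
  rot-keeps⁻ (inr r) (inr s) with rot-keeps⁻ r s
  ... | inj₁ e = inj₁ e
  ... | inj₂ s′ = inj₂ (inr s′)

  module _ {i j} {t t′ : Tree i j} (r : Rot a b c d t t′) where
    open Quad (rot-quad r)

    rot-loses : ¬ Span b d t′
    rot-loses s = spans-noncrossing (rot-new r) s (span-< ab) (span-< bc) (span-< cd)

    rot-gains : ¬ Span a c t
    rot-gains s = spans-noncrossing s (rot-old r) (span-< ab) (span-< bc) (span-< cd)

-- Trees that differ in at most one diagonal

AlmostIn : ∀ {i j} → Tree i j → Tree i j → Set
AlmostIn t t′ = ∀ {p q r s} → Span p q t → ¬ Span p q t′ → Span r s t → ¬ Span r s t′ →
                p ≡ r × q ≡ s

≡⊎missing : ∀ {i j} {t t′ : Tree i j} → Adj t t′ →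
            t ≡ t′ ⊎ ∃ λ p → ∃ λ q → Span p q t × ¬ Span p q t′
≡⊎missing same    = inj₁ refl
≡⊎missing (fwd r) = inj₂ (_ , _ , rot-old r , rot-loses r)
≡⊎missing (bwd r) = inj₂ (_ , _ , rot-new r , rot-gains r)

-- Only kj is missing from t′ and only ik′ from t; all other spans are shared. Non-crossing then
-- forces k′ to be the apex over kj and k the apex over ik′, and the remaining subtrees agree.
almost-rot : ∀ {i k k′ j} (A : Tree i k) (B : Tree k j) (A′ : Tree i k′) (B′ : Tree k′ j) → k < k′ →
             AlmostIn (node A B) (node A′ B′) → AlmostIn (node A′ B′) (node A B) →
             Rot i k k′ j (node A B) (node A′ B′)
almost-rot {i} {k} {k′} {j} A B A′ B′ k<k′ m m′ = go B A′ refl refl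
  where
  t  = node A B
  t′ = node A′ B′

  B∉t′ : ¬ Span k j t′
  B∉t′ s = spans-noncrossing (inl (here {t = A′})) s (tree-< A) k<k′ (tree-< B′)

  A′∉t : ¬ Span i k′ t
  A′∉t s = spans-noncrossing s (inr (here {t = B})) (tree-< A) k<k′ (tree-< B′)

  kept : ∀ {p q} → Span p q t → ¬ (p ≡ k × q ≡ j) → Span p q t′
  kept s ≢kj with span? t′
  ... | yes s′ = s′
  ... | no ¬s′ = ⊥-elim (≢kj (m s ¬s′ (inr (here {t = B})) B∉t′))

  kept′ : ∀ {p q} → Span p q t′ → ¬ (p ≡ i × q ≡ k′) → Span p q t
  kept′ s ≢ik with span? t
  ... | yes s′ = s′
  ... | no ¬s′ = ⊥-elim (≢ik (m′ s ¬s′ (inl (here {t = A′})) A′∉t))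

  go : (B₁ : Tree k j) (A₁ : Tree i k′) → B₁ ≡ B → A₁ ≡ A′ → Rot i k k′ j (node A B₁) (node A₁ B′)
  go leaf A₁ _ _ = ⊥-elim (<⇒≱ (tree-< B′) k<k′)
  go (node B₁ B₂) leaf _ _ = ⊥-elim (<⇒≱ (tree-< A) (≤-pred k<k′))
  go (node {k = l} B₁ B₂) (node {k = l′} A₁ A₂) refl refl with <-cmp l k′ | <-cmp l′ k
  ... | tri< l<k′ _ _ | _ = ⊥-elim (spans-noncrossing (inl (here {t = A′}))
          (kept (inr (inr (here {t = B₂}))) λ (l≡k , _) → <⇒≢ (tree-< B₁) (sym l≡k))
          (<-trans (tree-< A) (tree-< B₁)) l<k′ (tree-< B′))
  ... | tri> _ _ k′<l | _ = ⊥-elim (spans-noncrossing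
          (kept (inr (inl (here {t = B₁}))) λ (_ , l≡j) → <⇒≢ (tree-< B₂) l≡j)
          (inr (here {t = B′})) k<k′ k′<l (tree-< B₂))
  ... | tri≈ _ _ _ | tri< l′<k _ _ = ⊥-elim (spans-noncrossing (inl (here {t = A}))
          (kept′ (inl (inr (here {t = A₂}))) λ (l′≡i , _) → <⇒≢ (tree-< A₁) (sym l′≡i))
          (tree-< A₁) l′<k k<k′)
  ... | tri≈ _ _ _ | tri> _ _ k<l′ = ⊥-elim (spans-noncrossing
          (kept′ (inl (inl (here {t = A₁}))) λ (_ , l′≡k′) → <⇒≢ (tree-< A₂) l′≡k′)
          (inr (here {t = B})) (tree-< A) k<l′ (<-trans (tree-< A₂) (tree-< B′)))
  ... | tri≈ _ refl _ | tri≈ _ refl _ with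
        ⊆⇒≡ A A₁ (λ s → span-left (span-hi s) (span-left (≤-trans (span-hi s) (<⇒≤ k<k′))
               (kept (inl s) λ (_ , q≡j) → <⇒≢ (≤-<-trans (span-hi s) (tree-< B)) q≡j)))
      | ⊆⇒≡ B₁ A₂ (λ s → span-right (span-lo s) (span-left (span-hi s)
               (kept (inr (inl s)) λ (_ , q≡j) → <⇒≢ (≤-<-trans (span-hi s) (tree-< B′)) q≡j)))
      | ⊆⇒≡ B₂ B′ (λ s → span-right (span-lo s)
               (kept (inr (inr s)) λ (p≡k , _) → <⇒≢ (<-≤-trans k<k′ (span-lo s)) (sym p≡k)))
  ...   | refl | refl | refl = rot A B₁ B₂

-- Different apexes mean a flip at the root. With equal apexes, changes in both children would give
-- two missing spans, so one child is unchanged and recursion handles the other.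
almost⇒adj : ∀ {i j} (t t′ : Tree i j) → AlmostIn t t′ → AlmostIn t′ t → Adj t t′
almost⇒adj leaf leaf _ _ = same
almost⇒adj leaf (node A B) _ _ = ⊥-elim (<⇒≱ (tree-< A) (≤-pred (tree-< B)))
almost⇒adj (node A B) leaf _ _ = ⊥-elim (<⇒≱ (tree-< A) (≤-pred (tree-< B)))
almost⇒adj (node {k = k} A B) (node {k = k′} A′ B′) m m′ with <-cmp k k′
... | tri< k<k′ _ _ = fwd (almost-rot A B A′ B′ k<k′ m m′)
... | tri> _ _ k′<k = bwd (almost-rot A′ B′ A B k′<k m′ m)
... | tri≈ _ refl _ = combine (almost⇒adj A A′ (restrictˡ m) (restrictˡ m′))
                              (almost⇒adj B B′ (restrictʳ m) (restrictʳ m′))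
  where
  restrictˡ : ∀ {A A′ : Tree _ k} {B B′ : Tree k _} → AlmostIn (node A B) (node A′ B′) → AlmostIn A A′
  restrictˡ m s ¬s r ¬r = m (inl s) (λ x → ¬s (span-left (span-hi s) x))
                            (inl r) (λ x → ¬r (span-left (span-hi r) x))
  restrictʳ : ∀ {A A′ : Tree _ k} {B B′ : Tree k _} → AlmostIn (node A B) (node A′ B′) → AlmostIn B B′
  restrictʳ m s ¬s r ¬r = m (inr s) (λ x → ¬s (span-right (span-lo s) x))
                            (inr r) (λ x → ¬r (span-right (span-lo r) x))
  combine : Adj A A′ → Adj B B′ → Adj (node A B) (node A′ B′)
  combine x y with ≡⊎missing x | ≡⊎missing y
  ... | inj₁ refl | _ = adj-inr y
  ... | inj₂ _ | inj₁ refl = adj-inl x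
  ... | inj₂ (_ , _ , s , ¬s) | inj₂ (_ , _ , r , ¬r)
      with m (inl s) (λ x → ¬s (span-left (span-hi s) x)) (inr r) (λ x → ¬r (span-right (span-lo r) x))
  ...   | refl , refl = ⊥-elim (<⇒≱ (span-< r) (≤-trans (span-hi s) (span-lo r)))

-- Triangulations of the polygon and trees

module _ {A : Set} where

  remove : ∀ {x : A} {xs} → x ∈ xs → Unique xs →
           ∃ λ ys → length xs ≡ suc (length ys) × Unique ys ×
                    (∀ {y} → y ∈ ys → y ∈ xs × y ≢ x) × (∀ {y} → y ∈ xs → y ≢ x → y ∈ ys)
  remove {xs = x ∷ xs} (here refl) (x∉ ∷ u) =
    xs , refl , u , (λ y∈ → there y∈ , λ { refl → All.lookup x∉ y∈ refl })
       , λ { (here y≡x) y≢x → ⊥-elim (y≢x y≡x) ; (there y∈) _ → y∈ }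
  remove {xs = x ∷ xs} (there x∈) (x∉ ∷ u) with remove x∈ u
  ... | ys , eq , u′ , sub , sup = x ∷ ys , cong suc eq
      , All.tabulate (λ y∈ → All.lookup x∉ (proj₁ (sub y∈))) ∷ u′
      , (λ { (here refl) → here refl , λ { refl → All.lookup x∉ x∈ refl }
           ; (there y∈) → there (proj₁ (sub y∈)) , proj₂ (sub y∈) })
      , λ { (here y≡x) _ → here y≡x ; (there y∈) y≢x → there (sup y∈ y≢x) }

  unique-length-≤ : ∀ {xs ys : List A} → Unique xs → Unique ys → (∀ {x} → x ∈ xs → x ∈ ys) →
                    length xs ≤ length ys
  unique-length-≤ {[]} _ _ _ = z≤n
  unique-length-≤ {x ∷ xs} (x∉ ∷ u) v sub with remove (sub (here refl)) v
  ... | zs , eq , w , _ , sup = subst (suc (length xs) ≤_) (sym eq)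
        (s≤s (unique-length-≤ u w λ y∈ → sup (sub (there y∈)) λ { refl → All.lookup x∉ y∈ refl }))

nodes : ∀ {i j} → Tree i j → List (ℕ × ℕ)
nodes leaf = []
nodes {i} {j} (node A B) = (i , j) ∷ nodes A ++ nodes B

-- There are j - i leaves, hence j - i - 1 internal nodes; the additive form avoids truncated
-- subtraction.
nodes-length : ∀ {i j} (t : Tree i j) → length (nodes t) + suc i ≡ j
nodes-length leaf = refl
nodes-length {i} {j} (node {k = k} A B) = begin
  suc (length (nodes A ++ nodes B) + suc i)             ≡⟨ cong (λ l → suc (l + suc i)) (length-++ (nodes A)) ⟩
  suc (length (nodes A) + length (nodes B) + suc i)     ≡⟨ cong (λ l → suc (l + suc i)) (+-comm (length (nodes A)) _) ⟩
  suc (length (nodes B) + length (nodes A) + suc i)     ≡⟨ cong suc (+-assoc (length (nodes B)) _ _) ⟩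
  suc (length (nodes B) + (length (nodes A) + suc i))   ≡⟨ cong (λ l → suc (length (nodes B) + l)) (nodes-length A) ⟩
  suc (length (nodes B) + k)                            ≡⟨ +-suc _ k ⟨
  length (nodes B) + suc k                              ≡⟨ nodes-length B ⟩
  j                                                     ∎
  where open ≡-Reasoning

span⇒∈nodes : ∀ {p q i j} {t : Tree i j} → Span p q t → suc p < q → (p , q) ∈ nodes t
span⇒∈nodes {t = leaf} here p+2≤q = ⊥-elim (<-irrefl refl p+2≤q)
span⇒∈nodes {t = node A B} here _ = here refl
span⇒∈nodes (inl s) lt = there (∈-++⁺ˡ (span⇒∈nodes s lt))
span⇒∈nodes (inr {A = A} s) lt = there (∈-++⁺ʳ (nodes A) (span⇒∈nodes s lt))

∈nodes⇒span : ∀ {p q i j} (t : Tree i j) → (p , q) ∈ nodes t → Span p q t × suc p < q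
∈nodes⇒span (node A B) (here refl) = here , ≤-<-trans (tree-< A) (tree-< B)
∈nodes⇒span (node A B) (there x) with ∈-++⁻ (nodes A) x
... | inj₁ y = let s , lt = ∈nodes⇒span A y in inl s , lt
... | inj₂ y = let s , lt = ∈nodes⇒span B y in inr s , lt

nodes-unique : ∀ {i j} (t : Tree i j) → Unique (nodes t)
nodes-unique leaf = []
nodes-unique {i} {j} (node {k = k} A B) =
  All.tabulate root∉ ∷ Unique.++⁺ (nodes-unique A) (nodes-unique B) disjoint
  where
  root∉ : ∀ {x} → x ∈ nodes A ++ nodes B → (i , j) ≢ x
  root∉ x∈ refl with ∈-++⁻ (nodes A) x∈
  ... | inj₁ y = <⇒≱ (tree-< B) (span-hi (proj₁ (∈nodes⇒span A y)))
  ... | inj₂ y = <⇒≱ (tree-< A) (span-lo (proj₁ (∈nodes⇒span B y)))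
  disjoint : ∀ {x} → x ∈ nodes A × x ∈ nodes B → ⊥
  disjoint (x , y) = let s , _ = ∈nodes⇒span A x ; r , _ = ∈nodes⇒span B y in
    <⇒≱ (span-< s) (≤-trans (span-hi s) (span-lo r))

edge-span : ∀ {p i j} (t : Tree i j) → i ≤ p → p < j → Span p (suc p) t
edge-span t i≤p p<j = spans-maximal t i≤p ≤-refl p<j
  (λ _ r<p p<s s<1+p → <⇒≱ p<s (≤-pred s<1+p)) (λ _ p<r r<1+p _ → <⇒≱ p<r (≤-pred r<1+p))

does⇒ : ∀ {P : Set} (P? : Dec P) → does P? ≡ true → P
does⇒ (yes p) _ = p
does⇒ (no _) ()

≡true-ext : ∀ {x y} → (x ≡ true → y ≡ true) → (y ≡ true → x ≡ true) → x ≡ y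
≡true-ext {true} {y} f g = sym (f refl)
≡true-ext {false} {false} f g = refl
≡true-ext {false} {true} f g = g refl

module Triangulation (n : ℕ) where

  T : Set
  T = Tree 0 (n + 2)

  n+3≡ : n + 3 ≡ suc (n + 2)
  n+3≡ = +-suc n 2

  toℕ≤ : (i : Fin (n + 3)) → toℕ i ≤ n + 2
  toℕ≤ i = ≤-pred (subst (toℕ i <_) n+3≡ (toℕ<n i))

  -- Out-of-range arguments are sent to 0.
  fin : ℕ → Fin (n + 3)
  fin p with p <? n + 3
  ... | yes p<n+3 = fromℕ< p<n+3
  ... | no _      = fromℕ< (<-≤-trans z<s (m≤n+m 3 n))

  toℕ-fin : ∀ {p} → p ≤ n + 2 → toℕ (fin p) ≡ p
  toℕ-fin {p} p≤n+2 with p <? n + 3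
  ... | yes p<n+3 = toℕ-fromℕ< p<n+3
  ... | no p≮n+3 = ⊥-elim (p≮n+3 (subst (p <_) (sym n+3≡) (s≤s p≤n+2)))

  fin-toℕ : ∀ i → fin (toℕ i) ≡ i
  fin-toℕ i = toℕ-injective (toℕ-fin (toℕ≤ i))

  Diag : ℕ → ℕ → Set
  Diag p q = suc p < q × ¬ (p ≡ 0 × q ≡ n + 2)

  diag? : ∀ p q → Dec (Diag p q)
  diag? p q = suc p <? q ×-dec ¬? (p ≟ 0 ×-dec q ≟ n + 2)

  -- The sides and the base edge belong to every tree, so comparing diagonals is enough.
  ⊆-diag⇒≡ : (t t′ : T) → (∀ {p q} → Diag p q → Span p q t → Span p q t′) → t ≡ t′
  ⊆-diag⇒≡ t t′ sub = ⊆⇒≡ t t′ λ {p} {q} s → case s (diag? p q)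
    where
    case : ∀ {p q} → Span p q t → Dec (Diag p q) → Span p q t′
    case s (yes dg) = sub dg s
    case {p} {q} s (no ¬dg) with suc p <? q | p ≟ 0 | q ≟ n + 2
    ... | no ≮ | _ | _ with ≤-antisym (span-< s) (≮⇒≥ ≮)
    ...   | refl = edge-span t′ z≤n (span-hi s)
    case s (no ¬dg) | yes lt | yes refl | yes refl = here
    case s (no ¬dg) | yes lt | no ≢ | _ = ⊥-elim (¬dg (lt , λ (e , _) → ≢ e))
    case s (no ¬dg) | yes lt | yes _ | no ≢ = ⊥-elim (¬dg (lt , λ (_ , e) → ≢ e))

  diagSpan? : (t : T) → ∀ p q → Dec (Diag p q × Span p q t)
  diagSpan? t p q = diag? p q ×-dec span? t

  fromTree : T → Tri n
  fromTree t = record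
    { S        = λ i j → does (diagSpan? t (toℕ i) (toℕ j))
    ; onlyDiag = λ i j e → proj₁ (does⇒ (diagSpan? t (toℕ i) (toℕ j)) e)
    ; noCross  = λ a b c d e f → noCr (proj₂ (does⇒ (diagSpan? t (toℕ a) (toℕ b)) e))
                                      (proj₂ (does⇒ (diagSpan? t (toℕ c) (toℕ d)) f))
    ; maximal  = max
    }
    where
    noCr : ∀ {a b c d : Fin (n + 3)} → Span (toℕ a) (toℕ b) t → Span (toℕ c) (toℕ d) t → ¬ Cross a b c d
    noCr s r (inj₁ (x , y , z)) = spans-noncrossing s r x y z
    noCr s r (inj₂ (x , y , z)) = spans-noncrossing r s x y z
    max : ∀ i j → IsDiag n i j →
          (∀ c d → does (diagSpan? t (toℕ c) (toℕ d)) ≡ true → ¬ Cross i j c d) →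
          does (diagSpan? t (toℕ i) (toℕ j)) ≡ true
    -- A span crossing ij is neither a side nor the base edge, hence a diagonal of the set, and H
    -- excludes it.
    max i j dg H = dec-true (diagSpan? t (toℕ i) (toℕ j)) (dg , spans-maximal t z≤n (<⇒≤ (proj₁ dg)) (toℕ≤ j)
      (λ s r<i i<s s<j → no-cross s
        (≤-<-trans r<i i<s , λ (_ , e) → <⇒≢ (<-≤-trans s<j (toℕ≤ j)) e)
        (inj₂ (r<i , i<s , s<j)))
      (λ s i<r r<j j<s → no-cross s
        (≤-<-trans r<j j<s , λ (e , _) → <⇒≢ (≤-<-trans z≤n i<r) (sym e))
        (inj₁ (i<r , r<j , j<s))))
      where
      no-cross : ∀ {r s} → Span r s t → Diag r s →
                 (toℕ i < r × r < toℕ j × toℕ j < s) ⊎ (r < toℕ i × toℕ i < s × s < toℕ j) → ⊥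
      no-cross {r} {s} sp dg′ cr = H (fin r) (fin s) (dec-true (diagSpan? t _ _) (subst₂ Diag re se dg′ , sp′))
          (subst₂ (λ r s → (toℕ i < r × r < toℕ j × toℕ j < s) ⊎ (r < toℕ i × toℕ i < s × s < toℕ j)) re se cr)
        where
        re : r ≡ toℕ (fin r)
        re = sym (toℕ-fin (≤-trans (<⇒≤ (span-< sp)) (span-hi sp)))
        se : s ≡ toℕ (fin s)
        se = sym (toℕ-fin (span-hi sp))
        sp′ : Span (toℕ (fin r)) (toℕ (fin s)) t
        sp′ = subst₂ (λ r s → Span r s t) re se sp

  fromTree⇒ : ∀ t i j → S (fromTree t) i j ≡ true → Span (toℕ i) (toℕ j) t
  fromTree⇒ t i j e = proj₂ (does⇒ (diagSpan? t (toℕ i) (toℕ j)) e)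

  fromTree⇐ : ∀ t i j → IsDiag n i j → Span (toℕ i) (toℕ j) t → S (fromTree t) i j ≡ true
  fromTree⇐ t i j dg s = dec-true (diagSpan? t (toℕ i) (toℕ j)) (dg , s)

  -- From a maximal non-crossing set of diagonals to a tree

  module _ (σ : Tri n) where

    -- `S` holds diagonals only; with the sides and the base edge added, every triangle is bounded
    -- by edges.
    Edge : ℕ → ℕ → Set
    Edge p q = suc p ≡ q ⊎ (p ≡ 0 × q ≡ n + 2) ⊎ S σ (fin p) (fin q) ≡ true

    edge? : ∀ p q → Dec (Edge p q)
    edge? p q = suc p ≟ q ⊎-dec (p ≟ 0 ×-dec q ≟ n + 2) ⊎-dec (S σ (fin p) (fin q) Bool.≟ true)

    S⇒edge : ∀ i j → S σ i j ≡ true → Edge (toℕ i) (toℕ j)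
    S⇒edge i j e = inj₂ (inj₂ (subst₂ (λ i j → S σ i j ≡ true) (sym (fin-toℕ i)) (sym (fin-toℕ j)) e))

    edge⇒S : ∀ i j → IsDiag n i j → Edge (toℕ i) (toℕ j) → S σ i j ≡ true
    edge⇒S i j (lt , _) (inj₁ e) = ⊥-elim (<⇒≢ lt e)
    edge⇒S i j (_ , ≢) (inj₂ (inj₁ e)) = ⊥-elim (≢ e)
    edge⇒S i j _ (inj₂ (inj₂ e)) = subst₂ (λ i j → S σ i j ≡ true) (fin-toℕ i) (fin-toℕ j) e

    edges-noncrossing : ∀ {p q r s} → Edge p q → Edge r s → s ≤ n + 2 → p < r → r < q → q < s → ⊥
    edges-noncrossing (inj₁ refl) _ _ p<r r<q _ = <⇒≱ p<r (≤-pred r<q)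
    edges-noncrossing (inj₂ (inj₁ (_ , refl))) _ s≤ _ _ q<s = <⇒≱ q<s s≤
    edges-noncrossing _ (inj₁ refl) _ _ r<q q<s = <⇒≱ r<q (≤-pred q<s)
    edges-noncrossing _ (inj₂ (inj₁ (refl , _))) _ () _ _
    edges-noncrossing {p} {q} {r} {s} (inj₂ (inj₂ e)) (inj₂ (inj₂ f)) s≤ p<r r<q q<s =
      noCross σ (fin p) (fin q) (fin r) (fin s) e f
        (inj₁ (subst₂ _<_ pe re p<r , subst₂ _<_ re qe r<q , subst₂ _<_ qe se q<s))
      where
      q≤ : q ≤ n + 2
      q≤ = ≤-trans (<⇒≤ q<s) s≤
      r≤ : r ≤ n + 2
      r≤ = ≤-trans (<⇒≤ r<q) q≤
      se : s ≡ toℕ (fin s)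
      se = sym (toℕ-fin s≤)
      qe : q ≡ toℕ (fin q)
      qe = sym (toℕ-fin q≤)
      re : r ≡ toℕ (fin r)
      re = sym (toℕ-fin r≤)
      pe : p ≡ toℕ (fin p)
      pe = sym (toℕ-fin (≤-trans (<⇒≤ p<r) r≤))

    last-neighbour : ∀ i k → i < k →
      ∃ λ l → i < l × l ≤ k × Edge i l × (∀ p → l < p → p ≤ k → ¬ Edge i p)
    last-neighbour i (suc k) i<k with edge? i (suc k)
    ... | yes e = suc k , i<k , ≤-refl , e , λ p l<p p≤ → ⊥-elim (<⇒≱ l<p p≤)
    ... | no ¬e with m≤n⇒m<n∨m≡n (≤-pred i<k)
    ...   | inj₂ refl = ⊥-elim (¬e (inj₁ refl))
    ...   | inj₁ i<k′ with last-neighbour i k i<k′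
    ...     | l , i<l , l≤k , e , last = l , i<l , m≤n⇒m≤1+n l≤k , e , last′
      where
      last′ : ∀ p → l < p → p ≤ suc k → ¬ Edge i p
      last′ p l<p p≤ with m≤n⇒m<n∨m≡n p≤
      ... | inj₁ p<  = last p l<p (≤-pred p<)
      ... | inj₂ refl = ¬e

    -- The third vertex of the triangle on ij is the last neighbour k of i before j. An edge
    -- crossing kj would cross ij, cross ik, or join i to a vertex beyond k; so kj is a side, or
    -- maximality puts it into `S`.
    apex : ∀ i j → suc i < j → j ≤ n + 2 → Edge i j → ∃ λ k → i < k × k < j × Edge i k × Edge k j
    apex i (suc j) 1+i<j j≤ eij with last-neighbour i j (≤-pred 1+i<j)
    ... | k , i<k , k≤j , eik , last = k , i<k , s≤s k≤j , eik , ekj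
      where
      k≤ : k ≤ n + 2
      k≤ = ≤-trans (m≤n⇒m≤1+n k≤j) j≤
      ke : k ≡ toℕ (fin k)
      ke = sym (toℕ-fin k≤)
      je : suc j ≡ toℕ (fin (suc j))
      je = sym (toℕ-fin j≤)
      uncrossed : ∀ {c d} → Edge c d → d ≤ n + 2 →
                  (k < c × c < suc j × suc j < d) ⊎ (c < k × k < d × d < suc j) → ⊥
      uncrossed ecd d≤ (inj₁ (k<c , c<j , j<d)) = edges-noncrossing eij ecd d≤ (<-trans i<k k<c) c<j j<d
      uncrossed {c} {d} ecd d≤ (inj₂ (c<k , k<d , d<j)) with <-cmp c i
      ... | tri< c<i _ _ = edges-noncrossing ecd eij j≤ c<i (<-trans i<k k<d) d<j
      ... | tri≈ _ refl _ = last d k<d (≤-pred d<j) ecd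
      ... | tri> _ _ i<c = edges-noncrossing eik ecd d≤ i<c c<k k<d
      ekj : Edge k (suc j)
      ekj with m≤n⇒m<n∨m≡n k≤j
      ... | inj₂ refl = inj₁ refl
      ... | inj₁ k<j = inj₂ (inj₂ (maximal σ (fin k) (fin (suc j))
              (subst₂ Diag ke je (s≤s k<j , λ (e , _) → <⇒≢ (≤-<-trans z≤n i<k) (sym e)))
              λ c d Scd cr → uncrossed (S⇒edge c d Scd) (toℕ≤ d)
                (subst₂ (λ k j → (k < toℕ c × toℕ c < j × j < toℕ d) ⊎ (toℕ c < k × k < toℕ d × toℕ d < j))
                        (sym ke) (sym je) cr)))

    -- `fuel` bounds j - i, which drops in both recursive calls.
    build : ∀ fuel i j → j ≤ fuel + i → i < j → j ≤ n + 2 → Edge i j →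
            Σ (Tree i j) λ t → ∀ {p q} → Span p q t → Edge p q
    build zero i j j≤i i<j _ _ = ⊥-elim (<⇒≱ i<j j≤i)
    build (suc fuel) i j j≤f i<j j≤ e with m≤n⇒m<n∨m≡n i<j
    ... | inj₂ refl = leaf , λ { here → e }
    ... | inj₁ lt with apex i j lt j≤ e
    ...   | k , i<k , k<j , eik , ekj
          with build fuel i k (≤-pred (≤-trans k<j j≤f)) i<k (≤-trans (<⇒≤ k<j) j≤) eik
             | build fuel k j (≤-trans j≤f (≤-trans (≤-reflexive (sym (+-suc fuel i))) (+-monoʳ-≤ fuel i<k))) k<j j≤ ekj
    ...     | A , α | B , β = node A B , λ { here → e ; (inl s) → α s ; (inr s) → β s }

    toTree′ : Σ T λ t → ∀ {p q} → Span p q t → Edge p q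
    toTree′ = build (n + 2) 0 (n + 2) (m≤m+n _ 0) (<-≤-trans z<s (m≤n+m 2 n)) ≤-refl (inj₂ (inj₁ (refl , refl)))

    toTree : T
    toTree = proj₁ toTree′

    toTree⇒ : ∀ i j → IsDiag n i j → Span (toℕ i) (toℕ j) toTree → S σ i j ≡ true
    toTree⇒ i j dg s = edge⇒S i j dg (proj₂ toTree′ s)

    toTree⇐ : ∀ i j → S σ i j ≡ true → Span (toℕ i) (toℕ j) toTree
    toTree⇐ i j e = spans-maximal toTree z≤n (<⇒≤ (proj₁ (onlyDiag σ i j e))) (toℕ≤ j)
      (λ s → edges-noncrossing (proj₂ toTree′ s) (S⇒edge i j e) (toℕ≤ j))
      (λ s → edges-noncrossing (S⇒edge i j e) (proj₂ toTree′ s) (span-hi s))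

  -- Only up to `TriEq`, since the fields of `Tri` are functions and proofs; the round trip on
  -- trees, `to-from`, is an equality.
  from-to : ∀ σ → TriEq (fromTree (toTree σ)) σ
  from-to σ i j = ≡true-ext
    (λ e → toTree⇒ σ i j (onlyDiag (fromTree (toTree σ)) i j e) (fromTree⇒ (toTree σ) i j e))
    (λ e → fromTree⇐ (toTree σ) i j (onlyDiag σ i j e) (toTree⇐ σ i j e))

  onFin : (P : ℕ → ℕ → Set) → (∀ i j → P (toℕ i) (toℕ j)) → ∀ {p q} → p ≤ n + 2 → q ≤ n + 2 → P p q
  onFin P f p≤ q≤ = subst₂ P (toℕ-fin p≤) (toℕ-fin q≤) (f (fin _) (fin _))

  toTree-cong : ∀ σ τ → TriEq σ τ → toTree σ ≡ toTree τ
  toTree-cong σ τ eq = ⊆-diag⇒≡ _ _ λ dg s →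
    onFin (λ p q → Diag p q → Span p q (toTree σ) → Span p q (toTree τ))
      (λ i j dg s → toTree⇐ τ i j (trans (sym (eq i j)) (toTree⇒ σ i j dg s)))
      (≤-trans (<⇒≤ (span-< s)) (span-hi s)) (span-hi s) dg s

  to-from : ∀ t → toTree (fromTree t) ≡ t
  to-from t = sym (⊆-diag⇒≡ _ _ λ dg s →
    onFin (λ p q → Diag p q → Span p q t → Span p q (toTree (fromTree t)))
      (λ i j dg s → toTree⇐ (fromTree t) i j (fromTree⇐ t i j dg s))
      (≤-trans (<⇒≤ (span-< s)) (span-hi s)) (span-hi s) dg s)

  nodes-length-T : (t : T) → length (nodes t) ≡ suc n
  nodes-length-T t = +-cancelʳ-≡ 1 _ _ (trans (nodes-length t) (+-suc n 1))

  toℕ² : Fin (n + 3) × Fin (n + 3) → ℕ × ℕ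
  toℕ² (i , j) = toℕ i , toℕ j

  fin² : ℕ × ℕ → Fin (n + 3) × Fin (n + 3)
  fin² (p , q) = fin p , fin q

  near-sym : ∀ {σ τ : Tri n} → Near σ τ → Near τ σ
  near-sym (F , l , u , a) = F , l , u , All.map (λ (x , y) → y , x) a

  -- Nearness is equality or a single flip

  module _ (2≤n : 2 ≤ n) where

    1+n∸2 : 2 + suc (n ∸ 2) ≡ suc n
    1+n∸2 = cong suc (m+[n∸m]≡n 2≤n)

    -- Two different missing spans, the base edge and the n - 1 shared diagonals would be n + 2
    -- distinct internal nodes of a tree that has n + 1.
    near⇒almost : ∀ {σ τ : Tri n} → Near σ τ → AlmostIn (toTree σ) (toTree τ)
    near⇒almost {σ} {τ} (F , l , u , a) {p} {q} {r} {s} x ¬x y ¬y with ≡-dec _≟_ _≟_ (p , q) (r , s)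
    ... | yes e = ,-injective e
    ... | no pq≢rs = ⊥-elim (<⇒≱ (≤-reflexive (sym count)) (unique-length-≤ unique (nodes-unique (toTree σ)) sub))
      where
      L : List (ℕ × ℕ)
      L = (p , q) ∷ (r , s) ∷ (0 , n + 2) ∷ map toℕ² F
      count : length L ≡ suc (length (nodes (toTree σ)))
      count = trans (cong (λ l → 3 + l) (trans (length-map toℕ² F) l)) (cong suc (trans 1+n∸2 (sym (nodes-length-T (toTree σ)))))
      F∈τ : ∀ {v w} → (v , w) ∈ map toℕ² F → Span v w (toTree τ)
      F∈τ x∈ with ∈-map⁻ toℕ² x∈
      ... | (i , j) , ij∈F , refl = toTree⇐ τ i j (proj₂ (All.lookup a ij∈F))
      fresh : ∀ {v w} → ¬ Span v w (toTree τ) → All ((v , w) ≢_) ((0 , n + 2) ∷ map toℕ² F)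
      fresh ¬z = (λ { refl → ¬z here }) ∷ All.tabulate λ { z∈ refl → ¬z (F∈τ z∈) }
      root∉F : ∀ {z} → z ∈ map toℕ² F → (0 , n + 2) ≢ z
      root∉F z∈ refl with ∈-map⁻ toℕ² z∈
      ... | (i , j) , ij∈F , e = proj₂ (onlyDiag σ i j (proj₁ (All.lookup a ij∈F)))
              (sym (,-injectiveˡ e) , sym (,-injectiveʳ e))
      unique : Unique L
      unique = (pq≢rs ∷ fresh ¬x) ∷ fresh ¬y ∷ All.tabulate root∉F
             ∷ Unique.map⁺ (λ e → cong₂ _,_ (toℕ-injective (,-injectiveˡ e)) (toℕ-injective (,-injectiveʳ e))) u
      missing⇒node : ∀ {v w} → Span v w (toTree σ) → ¬ Span v w (toTree τ) → (v , w) ∈ nodes (toTree σ)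
      missing⇒node {v} {w} z ¬z with suc v <? w
      ... | yes lt = span⇒∈nodes z lt
      ... | no ≮ with ≤-antisym (span-< z) (≮⇒≥ ≮)
      ...   | refl = ⊥-elim (¬z (edge-span (toTree τ) z≤n (span-hi z)))
      sub : ∀ {z} → z ∈ L → z ∈ nodes (toTree σ)
      sub (here refl) = missing⇒node x ¬x
      sub (there (here refl)) = missing⇒node y ¬y
      sub (there (there (here refl))) = span⇒∈nodes here (≤-trans 2≤n (m≤m+n n 2))
      sub (there (there (there z∈))) with ∈-map⁻ toℕ² z∈
      ... | (i , j) , ij∈F , refl = let e = proj₁ (All.lookup a ij∈F) in
            span⇒∈nodes (toTree⇐ σ i j e) (proj₁ (onlyDiag σ i j e))

    near⇒adj : ∀ {σ τ : Tri n} → Near σ τ → Adj (toTree σ) (toTree τ)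
    near⇒adj {σ} {τ} σ~τ = almost⇒adj _ _ (near⇒almost {σ} {τ} σ~τ) (near⇒almost {τ} {σ} (near-sym {σ} {τ} σ~τ))

    diags : (t : T) → ∃ λ ds → length ds ≡ n × Unique ds ×
            (∀ {p q} → (p , q) ∈ ds → Diag p q × Span p q t) ×
            (∀ {p q} → Diag p q → Span p q t → (p , q) ∈ ds)
    diags t with remove (span⇒∈nodes (here {t = t}) (≤-trans 2≤n (m≤m+n n 2))) (nodes-unique t)
    ... | ds , l , u , sub , sup = ds , suc-injective (trans (sym l) (nodes-length-T t)) , u
        , (λ x∈ → let y∈ , ≢root = sub x∈ ; s , lt = ∈nodes⇒span t y∈ in
             (lt , λ (x , y) → ≢root (cong₂ _,_ x y)) , s)
        , λ (lt , ≢root) s → sup (span⇒∈nodes s lt) λ e → ≢root (,-injective e)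

    -- The diagonal to leave out of the common face. For `same` an arbitrary one is given up, so
    -- that exactly n - 1 remain in this case too.
    spare : ∀ {t t′ : T} → Adj t t′ → ∃ λ p → ∃ λ q → Diag p q × Span p q t ×
            (∀ {r s} → Span r s t → (r , s) ≢ (p , q) → Span r s t′)
    spare {t} same with diags t
    ... | [] , refl , _ = ⊥-elim (<⇒≱ 2≤n z≤n)
    ... | (p , q) ∷ _ , _ , _ , sub , _ = let dg , s = sub (here refl) in p , q , dg , s , λ r _ → r
    spare (fwd {b = b} {d = d} r) = b , d , (≤-<-trans (span-< bc) (span-< cd)
        , λ { (refl , _) → <⇒≱ (span-< ab) z≤n }) , rot-old r , keep
      where
      open Quad (rot-quad r)
      keep : ∀ {p q} → Span p q _ → (p , q) ≢ (b , d) → Span p q _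
      keep s s≢ with rot-keeps r s
      ... | inj₁ (refl , refl) = ⊥-elim (s≢ refl)
      ... | inj₂ s′ = s′
    spare (bwd {a = a} {c = c} r) = a , c , (≤-<-trans (span-< ab) (span-< bc)
        , λ { (_ , refl) → <⇒≱ (span-< cd) (span-hi cd) }) , rot-new r , keep
      where
      open Quad (rot-quad r)
      keep : ∀ {p q} → Span p q _ → (p , q) ≢ (a , c) → Span p q _
      keep s s≢ with rot-keeps⁻ r s
      ... | inj₁ (refl , refl) = ⊥-elim (s≢ refl)
      ... | inj₂ s′ = s′

    adj⇒near : ∀ {t t′ : T} → Adj t t′ → Near (fromTree t) (fromTree t′)
    adj⇒near {t} {t′} t~t′ with diags t | spare t~t′
    ... | ds , dl , du , dsub , dsup | p , q , dg , s , kept with remove (dsup dg s) du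
    ...   | F , l , u , sub , _ = map fin² F , trans (length-map fin² F) len , unique
            , All.map⁺ (All.tabulate λ x∈ → both (proj₁ (dsub (proj₁ (sub x∈)))) (proj₂ (dsub (proj₁ (sub x∈))))
                                             (kept (proj₂ (dsub (proj₁ (sub x∈)))) (proj₂ (sub x∈))))
      where
      len : length F ≡ suc (n ∸ 2)
      len = suc-injective (trans (sym l) (trans dl (sym (suc-injective 1+n∸2))))
      unfin : ∀ {x} → x ∈ F → toℕ² (fin² x) ≡ x
      unfin x∈ = let sp = proj₂ (dsub (proj₁ (sub x∈))) in
        cong₂ _,_ (toℕ-fin (≤-trans (<⇒≤ (span-< sp)) (span-hi sp))) (toℕ-fin (span-hi sp))
      unique : Unique (map fin² F)
      unique = Unique.map⁻ {f = toℕ²} (subst Unique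
        (sym (trans (sym (map-∘ F)) (map-id-local (All.tabulate unfin)))) u)
      both : ∀ {v w} → Diag v w → Span v w t → Span v w t′ →
             S (fromTree t) (fin v) (fin w) ≡ true × S (fromTree t′) (fin v) (fin w) ≡ true
      both {v} {w} dg s s′ =
          fromTree⇐ t (fin v) (fin w) (subst₂ Diag ve we dg) (subst₂ (λ v w → Span v w t) ve we s)
        , fromTree⇐ t′ (fin v) (fin w) (subst₂ Diag ve we dg) (subst₂ (λ v w → Span v w t′) ve we s′)
        where
        ve : v ≡ toℕ (fin v)
        ve = sym (toℕ-fin (≤-trans (<⇒≤ (span-< s)) (span-hi s)))
        we : w ≡ toℕ (fin w)
        we = sym (toℕ-fin (span-hi s))

-- Paths, homotopy and the abelianized loop group

module Paths (V : Set) (_~_ : V → V → Set) (~-refl : Reflexive _~_) (~-sym : Symmetric _~_) where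

  data Path : V → V → Set where
    stop : ∀ {x} → Path x x
    step : ∀ {x y z} → x ~ y → Path y z → Path x z

  toList : ∀ {x y} → Path x y → List V
  toList (stop {x})       = x ∷ []
  toList (step {x} _ p)   = x ∷ toList p

  infixr 6 _⊙_
  _⊙_ : ∀ {x y z} → Path x y → Path y z → Path x z
  stop ⊙ q     = q
  step e p ⊙ q = step e (p ⊙ q)

  rev : ∀ {x y} → Path x y → Path y x
  rev stop       = stop
  rev (step e p) = rev p ⊙ step (~-sym e) stop

  -- Homotopy of paths relative to end points in the complex with all 3- and 4-cycles filled;
  -- triangles and backtracks are squares with repeated corners.
  data _≃_ : ∀ {x y} → Path x y → Path x y → Set where
    stay    : ∀ {x y} (e : x ~ x) (p : Path x y) → step e p ≃ p
    square  : ∀ {x y y′ z u} (e : x ~ y) (f : y ~ z) (e′ : x ~ y′) (f′ : y′ ~ z) (p : Path z u) →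
              step e (step f p) ≃ step e′ (step f′ p)
    ≃-step  : ∀ {x y z} (e : x ~ y) {p q : Path y z} → p ≃ q → step e p ≃ step e q
    ≃-refl  : ∀ {x y} {p : Path x y} → p ≃ p
    ≃-sym   : ∀ {x y} {p q : Path x y} → p ≃ q → q ≃ p
    ≃-trans : ∀ {x y} {p q r : Path x y} → p ≃ q → q ≃ r → p ≃ r

  ≡⇒≃ : ∀ {x y} {p q : Path x y} → p ≡ q → p ≃ q
  ≡⇒≃ refl = ≃-refl

  ⊙-stop : ∀ {x y} (p : Path x y) → p ⊙ stop ≡ p
  ⊙-stop stop       = refl
  ⊙-stop (step e p) = cong (step e) (⊙-stop p)

  ⊙-assoc : ∀ {x y z u} (p : Path x y) (q : Path y z) (r : Path z u) → (p ⊙ q) ⊙ r ≡ p ⊙ q ⊙ r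
  ⊙-assoc stop q r       = refl
  ⊙-assoc (step e p) q r = cong (step e) (⊙-assoc p q r)

  ⊙-congʳ : ∀ {x y z} (p : Path x y) {q q′ : Path y z} → q ≃ q′ → (p ⊙ q) ≃ (p ⊙ q′)
  ⊙-congʳ stop h       = h
  ⊙-congʳ (step e p) h = ≃-step e (⊙-congʳ p h)

  ⊙-congˡ : ∀ {x y z} {p p′ : Path x y} (q : Path y z) → p ≃ p′ → (p ⊙ q) ≃ (p′ ⊙ q)
  ⊙-congˡ q (stay e p)           = stay e (p ⊙ q)
  ⊙-congˡ q (square e f e′ f′ p) = square e f e′ f′ (p ⊙ q)
  ⊙-congˡ q (≃-step e h)         = ≃-step e (⊙-congˡ q h)
  ⊙-congˡ q ≃-refl               = ≃-refl
  ⊙-congˡ q (≃-sym h)            = ≃-sym (⊙-congˡ q h)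
  ⊙-congˡ q (≃-trans h k)        = ≃-trans (⊙-congˡ q h) (⊙-congˡ q k)

  backtrack : ∀ {x y z} (e : x ~ y) (e′ : y ~ x) (p : Path x z) → step e (step e′ p) ≃ p
  backtrack e e′ p = ≃-trans (square e e′ ~-refl ~-refl p) (≃-trans (stay _ _) (stay _ _))

  triangle : ∀ {x y z u} (e : x ~ y) (f : y ~ z) (g : x ~ z) (p : Path z u) → step e (step f p) ≃ step g p
  triangle e f g p = ≃-trans (square e f ~-refl g p) (stay _ _)

  rev-inverseʳ : ∀ {x y} (p : Path x y) → (p ⊙ rev p) ≃ stop
  rev-inverseʳ stop       = ≃-refl
  rev-inverseʳ (step e p) = ≃-trans
    (≃-step e (≃-trans (≡⇒≃ (sym (⊙-assoc p (rev p) _))) (⊙-congˡ _ (rev-inverseʳ p))))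
    (backtrack e (~-sym e) stop)

  rev-inverseˡ : ∀ {x y} (p : Path x y) → (rev p ⊙ p) ≃ stop
  rev-inverseˡ stop       = ≃-refl
  rev-inverseˡ (step e p) = ≃-trans (≡⇒≃ (⊙-assoc (rev p) _ (step e p)))
    (≃-trans (⊙-congʳ (rev p) (backtrack (~-sym e) e p)) (rev-inverseˡ p))

  toList-⊙ : ∀ {x y z u} (p : Path x y) (e : y ~ z) (q : Path z u) →
             toList (p ⊙ step e q) ≡ toList p ++ toList q
  toList-⊙ stop e q       = refl
  toList-⊙ (step f p) e q = cong (_ ∷_) (toList-⊙ p e q)

  toList-rev : ∀ {x y} (p : Path x y) → toList (rev p) ≡ reverse (toList p)
  toList-rev stop           = refl
  toList-rev (step {x} e p) = trans (toList-⊙ (rev p) (~-sym e) stop)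
    (trans (cong (_++ (x ∷ [])) (toList-rev p)) (sym (unfold-reverse x (toList p))))

module Loops (n : ℕ) (2≤n : 2 ≤ n) (σ₀ : Tri n) where
  open Triangulation n public
  open Paths T Adj same adj-sym public

  t₀ : T
  t₀ = toTree σ₀

  F : List T → List (Tri n)
  F = map fromTree

  infix 4 _≃₀_ _≈₀_
  _≃₀_ _≈₀_ : List (Tri n) → List (Tri n) → Set
  _≃₀_ = _≃A_ {σ₀ = σ₀}
  _≈₀_ = _≈ab_ {σ₀ = σ₀}

  path-last : ∀ {x y} (p : Path x y) → TriEq (fromTree y) σ₀ → LastIs σ₀ (F (toList p))
  path-last stop eq                  = eq
  path-last (step _ stop) eq         = eq
  path-last (step _ p@(step _ _)) eq = path-last p eq

  path-linked : ∀ {x y} (p : Path x y) → Linked Near (F (toList p))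
  path-linked stop                = [-]
  path-linked (step e stop)       = adj⇒near 2≤n e ∷ [-]
  path-linked (step e p@(step _ _)) = adj⇒near 2≤n e ∷ path-linked p

  path-loop : (p : Path t₀ t₀) → IsLoop σ₀ (F (toList p))
  path-loop p = head p , path-last p (from-to σ₀) , path-linked p
    where
    head : (p : Path t₀ t₀) → HeadIs σ₀ (F (toList p))
    head stop       = from-to σ₀
    head (step _ _) = from-to σ₀

  F-pointwise : ∀ {xs ys} → Pointwise Adj xs ys → Pointwise Near (F xs) (F ys)
  F-pointwise []       = []
  F-pointwise (e ∷ es) = adj⇒near 2≤n e ∷ F-pointwise es

  -- The quantification over all continuations keeps the loop condition available while the part
  -- after the prefix is deformed.
  LoopAfter : List T → T → Set
  LoopAfter ys x = (p : Path x t₀) → IsLoop σ₀ (F (ys ++ toList p))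

  prefix-grid : ∀ ys {us vs} → IsLoop σ₀ (F (ys ++ us)) → IsLoop σ₀ (F (ys ++ vs)) → Pointwise Adj us vs →
                F (ys ++ us) ≃₀ F (ys ++ vs)
  prefix-grid ys l l′ pw = grid _ _ l l′ (F-pointwise (Pointwise.++⁺ (Pointwise.refl same) pw))

  repeat-head : ∀ ys {x} (p : Path x t₀) → LoopAfter ys x → F (ys ++ toList p) ≃₀ F (ys ++ x ∷ toList p)
  repeat-head ys {x} p L = go p (L p) (L (step same p))
    where
    go : (p : Path x t₀) → IsLoop σ₀ (F (ys ++ toList p)) → IsLoop σ₀ (F (ys ++ x ∷ toList p)) →
         F (ys ++ toList p) ≃₀ F (ys ++ x ∷ toList p)
    rep : ∀ zs → IsLoop σ₀ (F (ys ++ x ∷ zs)) → IsLoop σ₀ (F (ys ++ x ∷ x ∷ zs)) →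
          F (ys ++ x ∷ zs) ≃₀ F (ys ++ x ∷ x ∷ zs)
    rep zs rewrite map-++ fromTree ys (x ∷ zs) | map-++ fromTree ys (x ∷ x ∷ zs) = repeat _ _ _
    go stop       = rep _
    go (step _ p) = rep (toList p)

  loopAfter-∷ : ∀ ys {x y} → Adj x y → LoopAfter ys x → LoopAfter (ys ++ x ∷ []) y
  loopAfter-∷ ys {x} e L p = subst (λ zs → IsLoop σ₀ (F zs)) (sym (++-assoc ys (x ∷ []) (toList p))) (L (step e p))

  -- For a square, x is repeated in one list and z in the other. The lists x x y z ... and x y′ z z
  -- ... are then termwise adjacent, which is a one-step grid.
  ≃⇒≃A : ∀ ys {x} {p q : Path x t₀} → LoopAfter ys x → p ≃ q → F (ys ++ toList p) ≃₀ F (ys ++ toList q)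
  ≃⇒≃A ys L (stay e p) = sym′ (repeat-head ys p L)
  ≃⇒≃A ys {x} L (square {y = y} {y′} {z} e f e′ f′ p) = trans′ (repeat-head ys (step e (step f p)) L)
    (trans′ (prefix-grid ys (L (step same (step e (step f p)))) (L (step e′ (step f′ (step same p))))
              (same ∷ e′ ∷ f ∷ Pointwise.refl same))
            (sym′ (subst₂ (λ us vs → F us ≃₀ F vs) (++-assoc ys _ _) (++-assoc ys _ _)
               (repeat-head (ys ++ x ∷ y′ ∷ []) p
                  λ p′ → subst (λ zs → IsLoop σ₀ (F zs)) (sym (++-assoc ys _ _)) (L (step e′ (step f′ p′)))))))
  ≃⇒≃A ys {x} L (≃-step e h) = subst₂ (λ us vs → F us ≃₀ F vs) (++-assoc ys _ _) (++-assoc ys _ _)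
    (≃⇒≃A (ys ++ x ∷ []) (loopAfter-∷ ys e L) h)
  ≃⇒≃A ys L (≃-refl {p = p}) = refl′ _ (L p)
  ≃⇒≃A ys L (≃-sym h)        = sym′ (≃⇒≃A ys L h)
  ≃⇒≃A ys L (≃-trans h k)    = trans′ (≃⇒≃A ys L h) (≃⇒≃A ys L k)

  infix 4 _≈_
  -- A record, so that p and q can be inferred from the type; they cannot be recovered from
  -- `F (toList p)`.
  record _≈_ (p q : Path t₀ t₀) : Set where
    constructor ⟨_⟩
    field lists : F (toList p) ≈₀ F (toList q)
  open _≈_ public

  ≃⇒≈ : ∀ {p q : Path t₀ t₀} → p ≃ q → p ≈ q
  ≃⇒≈ h = ⟨ base (≃⇒≃A [] path-loop h) ⟩

  ≡⇒≈ : ∀ {p q : Path t₀ t₀} → p ≡ q → p ≈ q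
  ≡⇒≈ e = ≃⇒≈ (≡⇒≃ e)

  ≈-trans : ∀ {p q r} → p ≈ q → q ≈ r → p ≈ r
  ≈-trans ⟨ x ⟩ ⟨ y ⟩ = ⟨ trans′ x y ⟩

  -- Concatenating the lists repeats the base point, which corresponds to an additional `same` step;
  -- `stay` removes it.
  ++≈⊙ : (p q : Path t₀ t₀) → F (toList p) ++ F (toList q) ≈₀ F (toList (p ⊙ q))
  ++≈⊙ p q = subst (_≈₀ F (toList (p ⊙ q)))
    (trans (cong F (toList-⊙ p same q)) (map-++ fromTree (toList p) (toList q)))
    (lists (≃⇒≈ (⊙-congʳ p (stay same q))))

  ⊙-comm : ∀ p q → p ⊙ q ≈ q ⊙ p
  ⊙-comm p q = ⟨ trans′ (sym′ (++≈⊙ p q)) (trans′ (comm _ _ (path-loop p) (path-loop q)) (++≈⊙ q p)) ⟩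

  ⊙-cong : ∀ {p p′ q q′} → p ≈ p′ → q ≈ q′ → p ⊙ q ≈ p′ ⊙ q′
  ⊙-cong {p} {p′} {q} {q′} ⟨ x ⟩ ⟨ y ⟩ = ⟨ trans′ (sym′ (++≈⊙ p q)) (trans′ (cong· x y) (++≈⊙ p′ q′)) ⟩

  -- The relation has no rule for reversal, hence the group argument p⁻¹ = p⁻¹ q q⁻¹ = p⁻¹ p q⁻¹ =
  -- q⁻¹.
  rev-cong : ∀ {p q} → p ≈ q → rev p ≈ rev q
  rev-cong {p} {q} ⟨ x ⟩ =
    ≈-trans (≃⇒≈ (≃-trans (≡⇒≃ (sym (⊙-stop (rev p)))) (⊙-congʳ (rev p) (≃-sym (rev-inverseʳ q)))))
    (≈-trans (⊙-cong {rev p} (≡⇒≈ refl) (⊙-cong {q} {p} ⟨ sym′ x ⟩ (≡⇒≈ refl)))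
             (≃⇒≈ (≃-trans (≡⇒≃ (sym (⊙-assoc (rev p) p (rev q)))) (⊙-congˡ (rev q) (rev-inverseˡ p)))))

  loopGroup : AbelianGroup 0ℓ 0ℓ
  loopGroup = record
    { Carrier = Path t₀ t₀ ; _≈_ = _≈_ ; _∙_ = _⊙_ ; ε = stop ; _⁻¹ = rev
    ; isAbelianGroup = record
      { isGroup = record
        { isMonoid = record
          { isSemigroup = record
            { isMagma = record
              { isEquivalence = record { refl = ≡⇒≈ refl ; sym = λ (⟨ x ⟩) → ⟨ sym′ x ⟩ ; trans = ≈-trans }
              ; ∙-cong = ⊙-cong }
            ; assoc = λ p q r → ≡⇒≈ (⊙-assoc p q r) }
          ; identity = (λ p → ≡⇒≈ refl) , λ p → ≡⇒≈ (⊙-stop p) }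
        ; inverse = (λ p → ≃⇒≈ (rev-inverseˡ p)) , λ p → ≃⇒≈ (rev-inverseʳ p)
        ; ⁻¹-cong = rev-cong }
      ; comm = ⊙-comm } }

-- Flips at vertex 0 and the classes of single flips

-- Flips at the first vertex: they add a diagonal through it.
data Inc : ∀ {i j} → Tree i j → Tree i j → Set where
  rot : ∀ {i k l j} {A : Tree i k} {B : Tree k l} {C : Tree l j} →
        Inc (node A (node B C)) (node (node A B) C)
  inl : ∀ {i k j} {A A′ : Tree i k} {B : Tree k j} → Inc A A′ → Inc (node A B) (node A′ B)

inc⇒rot : ∀ {i j} {t t′ : Tree i j} → Inc t t′ → ∃ λ b → ∃ λ c → ∃ λ d → Rot i b c d t t′
inc⇒rot rot     = _ , _ , _ , rot _ _ _
inc⇒rot (inl r) = let b , c , d , r′ = inc⇒rot r in b , c , d , inl r′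

inc⇒adj : ∀ {i j} {t t′ : Tree i j} → Inc t t′ → Adj t t′
inc⇒adj r = fwd (proj₂ (proj₂ (proj₂ (inc⇒rot r))))

-- Canonical paths to the fan at the first vertex

data Top : ∀ {i j} → Tree i j → Set where
  leaf : ∀ {i} → Top (leaf {i})
  node : ∀ {i k} {X : Tree i k} → Top X → Top (node X leaf)

top-unique : ∀ {i j} {t t′ : Tree i j} → Top t → Top t′ → t ≡ t′
top-unique leaf leaf = refl
top-unique {t = t} leaf (node {X = X} _) = ⊥-elim (<-irrefl refl (tree-< X))
top-unique {t = node X leaf} (node _) leaf = ⊥-elim (<-irrefl refl (tree-< X))
top-unique (node x) (node y) = cong (λ X → node X leaf) (top-unique x y)

top-irrelevant : ∀ {i j} {t : Tree i j} (x y : Top t) → x ≡ y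
top-irrelevant leaf leaf         = refl
top-irrelevant (node x) (node y) = cong node (top-irrelevant x y)

-- A deterministic choice among the `Inc` flips: the left child is completed before the root is
-- rotated. This makes the path to the fan unique (`up-irrelevant`).
data Next : ∀ {i j} → Tree i j → Tree i j → Set where
  rot : ∀ {i k l j} {A : Tree i k} {B : Tree k l} {C : Tree l j} → Top A →
        Next (node A (node B C)) (node (node A B) C)
  inl : ∀ {i k j} {A A′ : Tree i k} {B : Tree k j} → Next A A′ → Next (node A B) (node A′ B)

next⇒inc : ∀ {i j} {t t′ : Tree i j} → Next t t′ → Inc t t′
next⇒inc (rot _) = rot
next⇒inc (inl r) = inl (next⇒inc r)

top-final : ∀ {i j} {t t′ : Tree i j} → Top t → ¬ Inc t t′
top-final (node x) (inl r) = top-final x r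

next-unique : ∀ {i j} {t t′ t″ : Tree i j} (r : Next t t′) (s : Next t t″) →
              _≡_ {A = ∃ (Next t)} (t′ , r) (t″ , s)
next-unique (rot x) (rot y) = cong (λ x → _ , rot x) (top-irrelevant x y)
next-unique (rot x) (inl s) = ⊥-elim (top-final x (next⇒inc s))
next-unique (inl r) (rot y) = ⊥-elim (top-final y (next⇒inc r))
next-unique (inl r) (inl s) = cong (λ (A′ , r) → node A′ _ , inl r) (next-unique r s)

data Up {i j : ℕ} (t : Tree i j) : Set where
  done : Top t → Up t
  up   : ∀ {t′} → Next t t′ → Up t′ → Up t

up-irrelevant : ∀ {i j} {t : Tree i j} (u v : Up t) → u ≡ v
up-irrelevant (done x) (done y) = cong done (top-irrelevant x y)
up-irrelevant (done x) (up r _) = ⊥-elim (top-final x (next⇒inc r))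
up-irrelevant (up r _) (done y) = ⊥-elim (top-final y (next⇒inc r))
up-irrelevant (up r u) (up s v) with next-unique r s
... | refl = cong (up r) (up-irrelevant u v)

climb-left : ∀ {i k j} {X : Tree i k} {B : Tree k j} → (∀ {Y} → Top Y → Up (node Y B)) → Up X → Up (node X B)
climb-left f (done x) = f x
climb-left f (up r u) = up (inl r) (climb-left f u)

-- Rotating X (P Q) to (X P) Q leaves only the attachment of P and then of Q to a fan, so the
-- recursion is structural in the right child.
climb-right : ∀ {i k j} {X : Tree i k} (B : Tree k j) → Top X → Up (node X B)
climb-right leaf x       = done (node x)
climb-right (node P Q) x = up (rot x) (climb-left (climb-right Q) (climb-right P x))

climb : ∀ {i j} (t : Tree i j) → Up t
climb leaf       = done leaf
climb (node X B) = climb-left (climb-right B) (climb X)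

peak : ∀ {i j} {t : Tree i j} → Up t → Σ (Tree i j) Top
peak (done x) = _ , x
peak (up _ u) = peak u

size : ∀ {i j} → Tree i j → ℕ
size leaf       = 0
size (node A B) = suc (size A + size B)

-- The number of internal nodes off the left spine, that is, of diagonals avoiding the first vertex.
slack : ∀ {i j} → Tree i j → ℕ
slack leaf       = 0
slack (node X B) = slack X + size B

inc-slack : ∀ {i j} {t t′ : Tree i j} → Inc t t′ → slack t ≡ suc (slack t′)
inc-slack (rot {A = A} {B} {C}) = trans (+-suc (slack A) _) (cong suc (sym (+-assoc (slack A) (size B) (size C))))
inc-slack (inl {B = B} r)       = cong (_+ size B) (inc-slack r)

-- A flip inside A commutes with the rotation of A (B C). One flip is canonical because `h-inc`
-- compares an arbitrary flip at the first vertex with the canonical one.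
diamond : ∀ {i j} {t t₁ t₂ : Tree i j} → Next t t₁ → Inc t t₂ →
          t₁ ≡ t₂ ⊎ ∃ λ u → Inc t₁ u × Inc t₂ u
diamond (rot x) rot     = inj₁ refl
diamond (rot x) (inl s) = ⊥-elim (top-final x s)
diamond (inl r) rot     = inj₂ (_ , rot , inl (inl (next⇒inc r)))
diamond (inl r) (inl s) with diamond r s
... | inj₁ refl         = inj₁ refl
... | inj₂ (u , x , y)  = inj₂ (_ , inl x , inl y)

fan : ∀ {i j} → i < j → Tree i j
fan {i} {suc j} i<j with m≤n⇒m<n∨m≡n (≤-pred i<j)
... | inj₁ i<j′  = node (fan i<j′) leaf
... | inj₂ refl  = leaf

-- Contexts of a subtree on the left spine: its right siblings, innermost first

data Tail (m : ℕ) : ℕ → Set where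
  []  : Tail m m
  _∷_ : ∀ {w v} → Tree w v → Tail m v → Tail m w

plug : ∀ {i w m} → Tail m w → Tree i w → Tree i m
plug [] Y      = Y
plug (R ∷ W) Y = plug W (node Y R)

plug-inc : ∀ {i w m} (W : Tail m w) {Y Y′ : Tree i w} → Inc Y Y′ → Inc (plug W Y) (plug W Y′)
plug-inc [] r      = r
plug-inc (R ∷ W) r = plug-inc W (inl r)

plug-adj : ∀ {i w m} (W : Tail m w) {Y Y′ : Tree i w} → Adj Y Y′ → Adj (plug W Y) (plug W Y′)
plug-adj [] e      = e
plug-adj (R ∷ W) e = plug-adj W (adj-inl e)

plug-rot : ∀ {a b c d i w m} (W : Tail m w) {Y Y′ : Tree i w} → Rot a b c d Y Y′ →
           Rot a b c d (plug W Y) (plug W Y′)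
plug-rot [] r      = r
plug-rot (R ∷ W) r = plug-rot W (inl r)

tail-≤ : ∀ {m w} → Tail m w → w ≤ m
tail-≤ []      = ≤-refl
tail-≤ (R ∷ W) = ≤-trans (<⇒≤ (tree-< R)) (tail-≤ W)

fanTail : ∀ {m w} → w ≤ m → Tail m w
fanTail w≤m with m≤n⇒m<n∨m≡n w≤m
... | inj₁ w<m  = fan w<m ∷ []
... | inj₂ refl = []

turn : ∀ {i a b c d} (X : Tree i a) (A : Tree a b) (B : Tree b c) (C : Tree c d) →
       Adj (node X (node A (node B C))) (node X (node (node A B) C))
turn X A B C = fwd (inr (rot A B C))

-- Classes of single flips in the abelianized loop group

module Generation (n : ℕ) (2≤n : 2 ≤ n) (σ₀ : Tri n) where
  open Loops n 2≤n σ₀ public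
  open AbelianGroup loopGroup public
    using (∙-cong; ∙-congˡ; ∙-congʳ; assoc; identityʳ; inverseʳ; ⁻¹-cong; setoid)
    renaming (refl to ≈-refl; sym to ≈-sym)
  open AbelianGroupProperties loopGroup using (∙-cancelʳ; inverseʳ-unique; identityˡ-unique)
  open SetoidReasoning setoid hiding (stop)

  ascend : ∀ {t s : T} → Top s → Up t → Path t s
  ascend y (done x) with top-unique x y
  ... | refl = stop
  ascend y (up r u) = step (inc⇒adj (next⇒inc r)) (ascend y u)

  top : T
  top = proj₁ (peak (climb t₀))

  top-top : Top top
  top-top = proj₂ (peak (climb t₀))

  rise : (t : T) → Path t top
  rise t = ascend top-top (climb t)

  core : ∀ {t t′} → Adj t t′ → Path top top
  core {t} {t′} e = rev (rise t) ⊙ step e (rise t′)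

  conj : Path top top → Path t₀ t₀
  conj p = rise t₀ ⊙ p ⊙ rev (rise t₀)

  conj-cong : ∀ {p q} → p ≃ q → conj p ≃ conj q
  conj-cong h = ⊙-congʳ (rise t₀) (⊙-congˡ _ h)

  conj-⊙ : ∀ p q → (conj p ⊙ conj q) ≃ conj (p ⊙ q)
  conj-⊙ p q = ≃-trans (≡⇒≃ (trans (⊙-assoc r _ _) (cong (r ⊙_) (⊙-assoc p (rev r) _))))
    (⊙-congʳ r (≃-trans (⊙-congʳ p (≃-trans (≡⇒≃ (sym (⊙-assoc (rev r) r _))) (⊙-congˡ _ (rev-inverseˡ r))))
                        (≡⇒≃ (sym (⊙-assoc p q (rev r))))))
    where r = rise t₀

  -- The standard generator that an edge contributes to the fundamental group, relative to the
  -- spanning tree of canonical paths rooted at `top`.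
  h : ∀ {t t′} → Adj t t′ → Path t₀ t₀
  h e = conj (core e)

  core-path : ∀ {t u w} (e : Adj t u) (p : Path u w) →
              (core e ⊙ rev (rise u) ⊙ p ⊙ rise w) ≃ (rev (rise t) ⊙ step e (p ⊙ rise w))
  core-path {t} {u} e p = ≃-trans (≡⇒≃ (⊙-assoc (rev (rise t)) (step e (rise u)) _))
    (⊙-congʳ (rev (rise t)) (≃-step e
      (≃-trans (≡⇒≃ (sym (⊙-assoc (rise u) _ _))) (⊙-congˡ _ (rev-inverseʳ (rise u))))))

  h-pair : ∀ {t u w} (e : Adj t u) (f : Adj u w) →
           h e ⊙ h f ≈ conj (rev (rise t) ⊙ step e (step f (rise w)))
  h-pair e f = ≃⇒≈ (≃-trans (conj-⊙ (core e) (core f)) (conj-cong (core-path e (step f stop))))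

  h-square : ∀ {t u v w} (e : Adj t u) (f : Adj u w) (e′ : Adj t v) (f′ : Adj v w) → h e ⊙ h f ≈ h e′ ⊙ h f′
  h-square {t} {w = w} e f e′ f′ = begin
    h e ⊙ h f                                             ≈⟨ h-pair e f ⟩
    conj (rev (rise t) ⊙ step e (step f (rise w)))        ≈⟨ ≃⇒≈ (conj-cong (⊙-congʳ (rev (rise t)) (square e f e′ f′ (rise w)))) ⟩
    conj (rev (rise t) ⊙ step e′ (step f′ (rise w)))      ≈⟨ h-pair e′ f′ ⟨
    h e′ ⊙ h f′                                           ∎

  h-triangle : ∀ {t u w} (e : Adj t u) (f : Adj u w) (g : Adj t w) → h e ⊙ h f ≈ h g
  h-triangle {t} {w = w} e f g = begin
    h e ⊙ h f                                             ≈⟨ h-pair e f ⟩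
    conj (rev (rise t) ⊙ step e (step f (rise w)))        ≈⟨ ≃⇒≈ (conj-cong (⊙-congʳ (rev (rise t)) (triangle e f g (rise w)))) ⟩
    h g                                                   ∎

  h-same : ∀ {t} (e : Adj t t) → h e ≈ stop
  h-same e = identityˡ-unique (h e) (h e) (h-triangle e e e)

  h-inverse : ∀ {t u} (e : Adj t u) (e′ : Adj u t) → h e′ ≈ rev (h e)
  h-inverse e e′ = inverseʳ-unique (h e) (h e′) (≈-trans (h-triangle e e′ same) (h-same same))

  -- A tree edge: by uniqueness the canonical path of t is this flip followed by that of t′, so the
  -- loop backtracks.
  h-next : ∀ {t t′} → Next t t′ → (e : Adj t t′) → h e ≈ stop
  h-next {t} {t′} r e with climb t | up-irrelevant (climb t) (up r (climb t′))
  ... | .(up r (climb t′)) | refl = ≃⇒≈ (≃-trans (conj-cong trivial) (rev-inverseʳ (rise t₀)))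
    where
    trivial : ((rev (rise t′) ⊙ step (adj-sym (inc⇒adj (next⇒inc r))) stop) ⊙ step e (rise t′)) ≃ stop
    trivial = ≃-trans (≡⇒≃ (⊙-assoc (rev (rise t′)) _ _))
      (≃-trans (⊙-congʳ (rev (rise t′)) (backtrack _ e (rise t′))) (rev-inverseˡ (rise t′)))

  -- Induction on `slack`. In the diamond of r and the canonical flip s, the edge s is a tree edge
  -- and the two closing edges start at smaller slack, so the square forces the class of r to be
  -- trivial.
  h-inc : ∀ {t t′} → Inc t t′ → (e : Adj t t′) → h e ≈ stop
  h-inc {t} r e = go (slack t) (climb t) refl r e
    where
    go : ∀ k {t t′} → Up t → slack t ≡ k → Inc t t′ → (e : Adj t t′) → h e ≈ stop
    go k (done x) eq r e = ⊥-elim (top-final x r)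
    go zero (up s _) eq r e with trans (sym eq) (inc-slack r)
    ... | ()
    go (suc k) (up s _) eq r e with diamond s r
    ... | inj₁ refl = h-next s e
    ... | inj₂ (u , x , y) = begin
          h e                                           ≈⟨ identityʳ (h e) ⟨
          h e ⊙ stop                                    ≈⟨ ∙-congˡ (go k (climb _) (lower r) y (inc⇒adj y)) ⟨
          h e ⊙ h (inc⇒adj y)                           ≈⟨ h-square e (inc⇒adj y) (inc⇒adj (next⇒inc s)) (inc⇒adj x) ⟩
          h (inc⇒adj (next⇒inc s)) ⊙ h (inc⇒adj x)      ≈⟨ ∙-cong (h-next s _) (go k (climb _) (lower (next⇒inc s)) x _) ⟩
          stop                                          ∎
      where
      lower : ∀ {t′} → Inc _ t′ → slack t′ ≡ k
      lower z = suc-injective (trans (sym (inc-slack z)) eq)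

  -- The transport principle for classes: the other two sides of the square are flips at vertex 0,
  -- hence trivial.
  inc-square : ∀ {t t′ u u′} → Inc t u → Inc t′ u′ → (e : Adj t t′) (f : Adj u u′) → h e ≈ h f
  inc-square r r′ e f = begin
    h e                       ≈⟨ identityʳ (h e) ⟨
    h e ⊙ stop                ≈⟨ ∙-congˡ (h-inc r′ (inc⇒adj r′)) ⟨
    h e ⊙ h (inc⇒adj r′)      ≈⟨ h-square e (inc⇒adj r′) (inc⇒adj r) f ⟩
    h (inc⇒adj r) ⊙ h f       ≈⟨ ∙-congʳ (h-inc r (inc⇒adj r)) ⟩
    h f                       ∎

  -- Every tree climbs to the same fan. It is applied to subpolygons, where `Inc` refers to their
  -- own first vertex and not to 0.
  connected : ∀ {i j} (f : Tree i j → Path t₀ t₀) → (∀ {t t′} → Inc t t′ → f t ≈ f t′) → ∀ t t′ → f t ≈ f t′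
  connected f f-inc t t′ = begin
    f t                             ≈⟨ to-peak (climb t) ⟩
    f (proj₁ (peak (climb t)))      ≈⟨ ≡⇒≈ (cong f (top-unique (proj₂ (peak (climb t))) (proj₂ (peak (climb t′))))) ⟩
    f (proj₁ (peak (climb t′)))     ≈⟨ to-peak (climb t′) ⟨
    f t′                            ∎
    where
    to-peak : ∀ {t} (u : Up t) → f t ≈ f (proj₁ (peak u))
    to-peak (done _) = ≈-refl
    to-peak (up r u) = ≈-trans (f-inc (next⇒inc r)) (to-peak u)

  plug-square : ∀ {w} (W : Tail (n + 2) w) {Y Y′ Z Z′ : Tree 0 w} → Inc Y Z → Inc Y′ Z′ →
                (e : Adj Y Y′) (f : Adj Z Z′) → h (plug-adj W e) ≈ h (plug-adj W f)
  plug-square W r r′ e f = inc-square (plug-inc W r) (plug-inc W r′) (plug-adj W e) (plug-adj W f)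

  -- Moving Y (P Q) to (Y P) Q is a flip at vertex 0 that commutes with any change of Y.
  split : ∀ {w v u} (P : Tree w v) (Q : Tree v u) (W : Tail (n + 2) u) {Y Y′ : Tree 0 w} (e : Adj Y Y′) →
          h (plug-adj (node P Q ∷ W) e) ≈ h (plug-adj (P ∷ Q ∷ W) e)
  split P Q W e = plug-square W rot rot (adj-inl e) (adj-inl (adj-inl e))

  -- The flip from R to R′ is not at vertex 0. Splitting both siblings along the spine gives the
  -- same context A, B, C, so the classes agree.
  reassociate : ∀ {w v} {R R′ : Tree w v} → Inc R R′ → (W : Tail (n + 2) v) {Y Y′ : Tree 0 w} (e : Adj Y Y′) →
                h (plug-adj (R ∷ W) e) ≈ h (plug-adj (R′ ∷ W) e)
  reassociate (rot {A = A} {B} {C}) W e = begin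
    h (plug-adj (node A (node B C) ∷ W) e)    ≈⟨ split A (node B C) W e ⟩
    h (plug-adj (A ∷ node B C ∷ W) e)         ≈⟨ split B C W (adj-inl e) ⟩
    h (plug-adj (A ∷ B ∷ C ∷ W) e)            ≈⟨ split A B (C ∷ W) e ⟨
    h (plug-adj (node A B ∷ C ∷ W) e)         ≈⟨ split (node A B) C W e ⟨
    h (plug-adj (node (node A B) C ∷ W) e)    ∎
  reassociate (inl {A = A} {A′} {B} r) W e = begin
    h (plug-adj (node A B ∷ W) e)     ≈⟨ split A B W e ⟩
    h (plug-adj (A ∷ B ∷ W) e)        ≈⟨ reassociate r (B ∷ W) e ⟩
    h (plug-adj (A′ ∷ B ∷ W) e)       ≈⟨ split A′ B W e ⟨
    h (plug-adj (node A′ B ∷ W) e)    ∎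

  merge : ∀ {w v} (R : Tree w v) (W : Tail (n + 2) v) → Σ (Tree w (n + 2)) λ R′ →
          ∀ {Y Y′ : Tree 0 w} (e : Adj Y Y′) → h (plug-adj (R ∷ W) e) ≈ h (plug-adj (R′ ∷ []) e)
  merge R [] = R , λ e → ≈-refl
  merge R (R₂ ∷ W) with merge R₂ W
  ... | R′ , eq = node R R′ , λ e → ≈-trans (eq (adj-inl e)) (≈-sym (split R R′ [] e))

  -- Each nonempty context merges into a single sibling, and any two siblings are joined by flips at
  -- their own first vertex. The empty context occurs only for w = n + 2.
  tail-irrelevant : ∀ {w} (W W′ : Tail (n + 2) w) {Y Y′ : Tree 0 w} (e : Adj Y Y′) →
                    h (plug-adj W e) ≈ h (plug-adj W′ e)
  tail-irrelevant [] [] e = ≈-refl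
  tail-irrelevant [] (R ∷ W) e = ⊥-elim (<⇒≱ (tree-< R) (tail-≤ W))
  tail-irrelevant (R ∷ W) [] e = ⊥-elim (<⇒≱ (tree-< R) (tail-≤ W))
  tail-irrelevant (R ∷ W) (R′ ∷ W′) e with merge R W | merge R′ W′
  ... | M , eq | M′ , eq′ = begin
    h (plug-adj (R ∷ W) e)      ≈⟨ eq e ⟩
    h (plug-adj (M ∷ []) e)     ≈⟨ connected (λ M → h (plug-adj (M ∷ []) e)) (λ r → reassociate r [] e) M M′ ⟩
    h (plug-adj (M′ ∷ []) e)    ≈⟨ eq′ e ⟨
    h (plug-adj (R′ ∷ W′) e)    ∎

  -- Both sides of the flip lead by flips at vertex 0 to the triangulation with fan ((X A) B) C,
  -- so a change of A, B, C has the same class before and after the flip (a pentagonal prism).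
  turn-cong : ∀ {a b c d} (W : Tail (n + 2) d) (X : Tree 0 a)
              {A A′ : Tree a b} {B B′ : Tree b c} {C C′ : Tree c d} →
              Adj (node X (node A (node B C))) (node X (node A′ (node B′ C′))) →
              Adj (node X (node (node A B) C)) (node X (node (node A′ B′) C′)) →
              Adj (node (node X A) (node B C)) (node (node X A′) (node B′ C′)) →
              Adj (node (node X (node A B)) C) (node (node X (node A′ B′)) C′) →
              Adj (node (node (node X A) B) C) (node (node (node X A′) B′) C′) →
              h (plug-adj W (turn X A B C)) ≈ h (plug-adj W (turn X A′ B′ C′))
  turn-cong W X {A} {A′} {B} {B′} {C} {C′} e₁ e₂ e₃ e₄ e₅ =
    ∙-cancelʳ (h (plug-adj W e₂)) _ _ (begin
      h (plug-adj W (turn X A B C)) ⊙ h (plug-adj W e₂)         ≈⟨ h-square _ _ _ _ ⟩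
      -- Commutativity of the abelianized group enters here: e₁ has to pass the turn before it can
      -- be replaced by e₂ and cancelled.
      h (plug-adj W e₁) ⊙ h (plug-adj W (turn X A′ B′ C′))      ≈⟨ ⊙-comm (h (plug-adj W e₁)) _ ⟩
      h (plug-adj W (turn X A′ B′ C′)) ⊙ h (plug-adj W e₁)      ≈⟨ ∙-congˡ {h (plug-adj W (turn X A′ B′ C′))} e₁≈e₂ ⟩
      h (plug-adj W (turn X A′ B′ C′)) ⊙ h (plug-adj W e₂)      ∎)
    where
    e₁≈e₂ : h (plug-adj W e₁) ≈ h (plug-adj W e₂)
    e₁≈e₂ = begin
      h (plug-adj W e₁)   ≈⟨ plug-square W rot rot e₁ e₃ ⟩
      h (plug-adj W e₃)   ≈⟨ plug-square W rot rot e₃ e₅ ⟩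
      h (plug-adj W e₅)   ≈⟨ plug-square W (inl rot) (inl rot) e₄ e₅ ⟨
      h (plug-adj W e₄)   ≈⟨ plug-square W rot rot e₂ e₄ ⟨
      h (plug-adj W e₂)   ∎

  -- One piece is changed at a time. Canonical flips of X are at vertex 0 of the whole polygon, so
  -- `plug-square` applies; those of A, B, C are not and need `turn-cong`.
  turn-irrelevant : ∀ {a b c d} (W W′ : Tail (n + 2) d) (X X′ : Tree 0 a)
                    (A A′ : Tree a b) (B B′ : Tree b c) (C C′ : Tree c d) →
                    h (plug-adj W (turn X A B C)) ≈ h (plug-adj W′ (turn X′ A′ B′ C′))
  turn-irrelevant W W′ X X′ A A′ B B′ C C′ = begin
    h (plug-adj W  (turn X  A  B  C ))  ≈⟨ tail-irrelevant W W′ (turn X A B C) ⟩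
    h (plug-adj W′ (turn X  A  B  C ))  ≈⟨ connected (λ X → h (plug-adj W′ (turn X A B C)))
                                             (λ r → plug-square W′ (inl r) (inl r) _ _) X X′ ⟩
    h (plug-adj W′ (turn X′ A  B  C ))  ≈⟨ connected (λ A → h (plug-adj W′ (turn X′ A B C)))
                                             (λ r → let e = inc⇒adj r in turn-cong W′ X′
                                               (adj-inr (adj-inl e)) (adj-inr (adj-inl (adj-inl e)))
                                               (adj-inl (adj-inr e)) (adj-inl (adj-inr (adj-inl e)))
                                               (adj-inl (adj-inl (adj-inr e)))) A A′ ⟩
    h (plug-adj W′ (turn X′ A′ B  C ))  ≈⟨ connected (λ B → h (plug-adj W′ (turn X′ A′ B C)))
                                             (λ r → let e = inc⇒adj r in turn-cong W′ X′
                                               (adj-inr (adj-inr (adj-inl e))) (adj-inr (adj-inl (adj-inr e)))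
                                               (adj-inr (adj-inl e)) (adj-inl (adj-inr (adj-inr e)))
                                               (adj-inl (adj-inr e))) B B′ ⟩
    h (plug-adj W′ (turn X′ A′ B′ C ))  ≈⟨ connected (λ C → h (plug-adj W′ (turn X′ A′ B′ C)))
                                             (λ r → let e = inc⇒adj r in turn-cong W′ X′
                                               (adj-inr (adj-inr (adj-inr e))) (adj-inr (adj-inr e))
                                               (adj-inr (adj-inr e)) (adj-inr e)
                                               (adj-inr e)) C C′ ⟩
    h (plug-adj W′ (turn X′ A′ B′ C′))  ∎

  record IsTurn (p : Path t₀ t₀) : Set where
    field
      {a b c d} : ℕ
      W : Tail (n + 2) d
      X : Tree 0 a
      A : Tree a b
      B : Tree b c
      C : Tree c d
      eq : p ≈ h (plug-adj W (turn X A B C))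

  isTurn-≈ : ∀ {p q} → p ≈ q → IsTurn q → IsTurn p
  isTurn-≈ p≈q t = record { IsTurn t ; eq = ≈-trans p≈q (IsTurn.eq t) }

  -- Flips at 0 rotate the right child into the left spine until the quadrilateral itself is a right
  -- child on the spine. Each of them commutes with r.
  rot-turn : ∀ {a b c d v w} {s s′ : Tree v w} (r : Rot a b c d s s′) (X : Tree 0 v) (W : Tail (n + 2) w) →
             IsTurn (h (plug-adj W (fwd (inr {A = X} r))))
  rot-turn (rot A B C) X W = record { W = W ; X = X ; A = A ; B = B ; C = C ; eq = ≈-refl }
  rot-turn (inl {A = P} {B = R} r) X W =
    isTurn-≈ (plug-square W rot rot (fwd (inr (inl r))) (fwd (inl (inr r)))) (rot-turn r X (R ∷ W))
  rot-turn (inr {A = P} r) X W =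
    isTurn-≈ (plug-square W rot rot (fwd (inr (inr r))) (fwd (inr r))) (rot-turn r (node X P) W)

  -- The position of r is followed down the left spine: on the spine the flip is at vertex 0, and at
  -- the first step to the right `rot-turn` takes over.
  rot-trivial⊎turn : ∀ {a b c d w} {Y Y′ : Tree 0 w} (r : Rot a b c d Y Y′) (W : Tail (n + 2) w) →
                     h (plug-adj W (fwd r)) ≈ stop ⊎ IsTurn (h (plug-adj W (fwd r)))
  rot-trivial⊎turn (rot A B C) W = inj₁ (h-inc (plug-inc W rot) _)
  rot-trivial⊎turn (inl {B = R} r) W = rot-trivial⊎turn r (R ∷ W)
  rot-trivial⊎turn (inr {A = X} r) W = inj₂ (rot-turn r X W)

  hs : ∀ {x y} → Path x y → Path t₀ t₀
  hs stop       = stop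
  hs (step e p) = h e ⊙ hs p

  conj-path : ∀ {x y} (p : Path x y) → conj (rev (rise x) ⊙ p ⊙ rise y) ≃ hs p
  conj-path {x} stop = ≃-trans (conj-cong (rev-inverseˡ (rise x))) (rev-inverseʳ (rise t₀))
  conj-path (step e p) = ≃-trans (conj-cong (≃-sym (core-path e p)))
    (≃-trans (≃-sym (conj-⊙ (core e) _)) (⊙-congʳ (h e) (conj-path p)))

  -- Between consecutive edges the canonical paths cancel, so a loop is the product of the classes
  -- of its edges.
  loop≈hs : (p : Path t₀ t₀) → p ≈ hs p
  loop≈hs p = begin
    p                                             ≈⟨ ≡⇒≈ (sym (⊙-stop p)) ⟩
    p ⊙ stop                                      ≈⟨ ≃⇒≈ (⊙-congʳ p (rev-inverseʳ r)) ⟨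
    p ⊙ r ⊙ rev r                                 ≈⟨ ≃⇒≈ (⊙-congˡ (p ⊙ r ⊙ rev r) (rev-inverseʳ r)) ⟨
    (r ⊙ rev r) ⊙ p ⊙ r ⊙ rev r                   ≈⟨ ≡⇒≈ (⊙-assoc r (rev r) _) ⟩
    r ⊙ rev r ⊙ p ⊙ r ⊙ rev r                     ≈⟨ ≡⇒≈ (cong (r ⊙_) (trans (cong (rev r ⊙_) (sym (⊙-assoc p r (rev r)))) (sym (⊙-assoc (rev r) _ (rev r))))) ⟩
    conj (rev r ⊙ p ⊙ r)                          ≈⟨ ≃⇒≈ (conj-path p) ⟩
    hs p                                          ∎
    where r = rise t₀

-- Enumeration of quadrilaterals

-- Strictly decreasing vectors encode k-subsets of 0, ..., m - 1. With the largest entry first,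
-- Pascal's recursion asks whether the head is the top element.
data Below (m : ℕ) : ∀ {k} → Vec ℕ k → Set where
  []  : Below m []
  _∷_ : ∀ {x k} {xs : Vec ℕ k} → x < m → Below x xs → Below m (x ∷ xs)

combinations : (m k : ℕ) → List (Vec ℕ k)
combinations m zero          = [] ∷ []
combinations zero (suc k)    = []
combinations (suc m) (suc k) = map (m ∷_) (combinations m k) ++ combinations m (suc k)

combinations-length : ∀ m k → length (combinations m k) ≡ m Combinatorics.C k
combinations-length m zero          = refl
combinations-length zero (suc k)    = refl
combinations-length (suc m) (suc k) = trans (length-++ (map (m ∷_) (combinations m k)))
  (trans (cong₂ _+_ (trans (length-map (m ∷_) (combinations m k)) (combinations-length m k)) (combinations-length m (suc k)))
         (Combinatorics.nCk+nC[k+1]≡[n+1]C[k+1] m k))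

below-suc : ∀ {m k} {v : Vec ℕ k} → Below m v → Below (suc m) v
below-suc []         = []
below-suc (x<m ∷ xs) = m<n⇒m<1+n x<m ∷ xs

∈-combinations⇒below : ∀ m k {v : Vec ℕ k} → v ∈ combinations m k → Below m v
∈-combinations⇒below m zero (here refl) = []
∈-combinations⇒below (suc m) (suc k) v∈ with ∈-++⁻ (map (m ∷_) (combinations m k)) v∈
... | inj₂ v∈′ = below-suc (∈-combinations⇒below m (suc k) v∈′)
... | inj₁ v∈′ with ∈-map⁻ (m ∷_) v∈′
...   | u , u∈ , refl = n<1+n m ∷ ∈-combinations⇒below m k u∈

below⇒∈-combinations : ∀ m {k} {v : Vec ℕ k} → Below m v → v ∈ combinations m k
below⇒∈-combinations m []                = here refl
below⇒∈-combinations (suc m) (x<1+m ∷ b) with m≤n⇒m<n∨m≡n (≤-pred x<1+m)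
... | inj₁ x<m  = ∈-++⁺ʳ (map (m ∷_) (combinations m _)) (below⇒∈-combinations m (x<m ∷ b))
... | inj₂ refl = ∈-++⁺ˡ (∈-map⁺ (m ∷_) (below⇒∈-combinations m b))

combinations-unique : ∀ m k → Unique (combinations m k)
combinations-unique m zero          = [] ∷ []
combinations-unique zero (suc k)    = []
combinations-unique (suc m) (suc k) = Unique.++⁺
  (Unique.map⁺ ∷-injectiveʳ (combinations-unique m k)) (combinations-unique m (suc k)) disjoint
  where
  disjoint : ∀ {v} → v ∈ map (m ∷_) (combinations m k) × v ∈ combinations m (suc k) → ⊥
  disjoint (x , y) with ∈-map⁻ (m ∷_) x
  ... | u , _ , refl with ∈-combinations⇒below m (suc k) y
  ...   | m<m ∷ _ = <-irrefl refl m<m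

lookup-injective : ∀ {A : Set} {xs : List A} → Unique xs → ∀ i j → lookup xs i ≡ lookup xs j → i ≡ j
lookup-injective (_ ∷ _) zero zero _         = refl
lookup-injective {xs = _ ∷ xs} (x∉ ∷ _) zero (suc j) e = ⊥-elim (All.lookup x∉ (∈-lookup j) e)
lookup-injective {xs = _ ∷ xs} (x∉ ∷ _) (suc i) zero e = ⊥-elim (All.lookup x∉ (∈-lookup i) (sym e))
lookup-injective (_ ∷ u) (suc i) (suc j) e   = cong suc (lookup-injective u i j e)

-- N is a parameter, so that the equation between a length and a binomial coefficient is transported
-- only once.
record Enumeration (m k N : ℕ) : Set where
  field
    at           : Fin N → Vec ℕ k
    at-below     : ∀ i → Below m (at i)
    at-injective : ∀ i j → at i ≡ at j → i ≡ j
    position     : ∀ {v} → Below m v → ∃ λ i → at i ≡ v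

enumeration : ∀ m k → Enumeration m k (m Combinatorics.C k)
enumeration m k = subst (Enumeration m k) (combinations-length m k) record
  { at           = lookup (combinations m k)
  ; at-below     = λ i → ∈-combinations⇒below m k (∈-lookup i)
  ; at-injective = lookup-injective (combinations-unique m k)
  ; position     = λ b → let v∈ = below⇒∈-combinations m b in index v∈ , sym (lookup-index v∈)
  }

-- Spanning

-- Successor and predecessor with the case split of `pow`, so that several power laws hold by
-- computation.
increment decrement : ℤ → ℤ
increment (+ k)        = + suc k
increment -[1+ zero ]  = + 0
increment -[1+ suc k ] = -[1+ k ]
decrement (+ zero)     = -[1+ 0 ]
decrement (+ suc k)    = + k
decrement -[1+ k ]     = -[1+ suc k ]

module Spanning (n : ℕ) (2≤n : 2 ≤ n) (σ₀ : Tri n) where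
  open Generation n 2≤n σ₀ public
  open SetoidReasoning setoid hiding (stop)

  power : Path t₀ t₀ → ℤ → Path t₀ t₀
  power p (+ zero)     = stop
  power p (+ suc k)    = p ⊙ power p (+ k)
  power p -[1+ zero ]  = rev p
  power p -[1+ suc k ] = rev p ⊙ power p -[1+ k ]

  combination : ∀ {N} → (Fin N → Path t₀ t₀) → (Fin N → ℤ) → Path t₀ t₀
  combination {zero}  b c = stop
  combination {suc N} b c = power (b zero) (c zero) ⊙ combination (λ i → b (suc i)) (λ i → c (suc i))

  ⊙-cancel : (p q : Path t₀ t₀) → rev p ⊙ p ⊙ q ≈ q
  ⊙-cancel p q = ≃⇒≈ (≃-trans (≡⇒≃ (sym (⊙-assoc (rev p) p q))) (⊙-congˡ q (rev-inverseˡ p)))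

  ⊙-cancel′ : (p q : Path t₀ t₀) → p ⊙ rev p ⊙ q ≈ q
  ⊙-cancel′ p q = ≃⇒≈ (≃-trans (≡⇒≃ (sym (⊙-assoc p (rev p) q))) (⊙-congˡ q (rev-inverseʳ p)))

  power-increment : ∀ p z → power p (increment z) ≈ p ⊙ power p z
  power-increment p (+ k)        = ≈-refl
  power-increment p -[1+ zero ]  = ≈-sym (inverseʳ p)
  power-increment p -[1+ suc k ] = ≈-sym (⊙-cancel′ p (power p -[1+ k ]))

  power-decrement : ∀ p z → power p (decrement z) ≈ rev p ⊙ power p z
  power-decrement p (+ zero)  = ≡⇒≈ (sym (⊙-stop (rev p)))
  power-decrement p (+ suc k) = ≈-sym (⊙-cancel p (power p (+ k)))
  power-decrement p -[1+ k ]  = ≈-refl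

  combination-updateAt : ∀ {N} (b : Fin N → Path t₀ t₀) (c : Fin N → ℤ) i (f : ℤ → ℤ) {q} →
    power (b i) (f (c i)) ≈ q ⊙ power (b i) (c i) →
    combination b (updateAt c i f) ≈ q ⊙ combination b c
  combination-updateAt b c zero f {q} eq = ≈-trans (∙-congʳ eq) (assoc q _ _)
  combination-updateAt b c (suc i) f {q} eq = begin
    x ⊙ combination (λ i → b (suc i)) (updateAt (λ i → c (suc i)) i f)
                      ≈⟨ ∙-congˡ {x} (combination-updateAt (λ i → b (suc i)) (λ i → c (suc i)) i f eq) ⟩
    x ⊙ q ⊙ y         ≈⟨ assoc x q y ⟨
    (x ⊙ q) ⊙ y       ≈⟨ ∙-congʳ (⊙-comm x q) ⟩
    (q ⊙ x) ⊙ y       ≈⟨ assoc q x y ⟩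
    q ⊙ x ⊙ y         ∎
    where
    x = power (b zero) (c zero)
    y = combination (λ i → b (suc i)) (λ i → c (suc i))

  combination-0 : ∀ {N} (b : Fin N → Path t₀ t₀) → combination b (λ _ → + 0) ≈ stop
  combination-0 {zero} b  = ≈-refl
  combination-0 {suc N} b = combination-0 (λ i → b (suc i))

  -- The flip of the quadrilateral with vertices a+1 < b+1 < c+1 < d+1, in a triangulation
  -- that also contains the triangle 0, a+1, d+1.
  generator : {v : Vec ℕ 4} → Below (n + 2) v → Path t₀ t₀
  generator (d< ∷ c<d ∷ b<c ∷ a<b ∷ []) =
    h (plug-adj (fanTail d<) (turn (fan z<s) (fan (s≤s a<b)) (fan (s≤s b<c)) (fan (s≤s c<d))))

  turn≈generator : ∀ {a b c d} (W : Tail (n + 2) (suc d)) (X : Tree 0 (suc a))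
                   (A : Tree (suc a) (suc b)) (B : Tree (suc b) (suc c)) (C : Tree (suc c) (suc d)) →
                   (β : Below (n + 2) (d ∷ c ∷ b ∷ a ∷ [])) → h (plug-adj W (turn X A B C)) ≈ generator β
  turn≈generator W X A B C (d< ∷ c<d ∷ b<c ∷ a<b ∷ []) =
    turn-irrelevant W (fanTail d<) X (fan z<s) A (fan (s≤s a<b)) B (fan (s≤s b<c)) C (fan (s≤s c<d))

  -- Lets a single grid step replace the terms of a loop by their normal forms.
  near-tree : ∀ σ → Near σ (fromTree (toTree σ))
  near-tree σ = let L , l , u , a = adj⇒near 2≤n {toTree σ} same in
    L , l , u , All.map (λ (x , y) → trans (sym (from-to σ _ _)) x , y) a

  pow≈power : ∀ p z → pow σ₀ (F (toList p)) z ≈₀ F (toList (power p z))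
  pow≈power p (+ zero)     = base (grid _ _ ((λ _ _ → refl) , (λ _ _ → refl) , [-]) (path-loop stop) (near-tree σ₀ ∷ []))
  pow≈power p (+ suc k)    = trans′ (cong· (lists (≈-refl {p})) (pow≈power p (+ k))) (++≈⊙ p _)
  pow≈power p -[1+ zero ]  = subst (_≈₀ F (toList (rev p)))
    (trans (cong F (toList-rev p)) (reverse-map fromTree (toList p))) (lists (≈-refl {rev p}))
  pow≈power p -[1+ suc k ] = trans′ (cong· (pow≈power p -[1+ 0 ]) (pow≈power p -[1+ k ])) (++≈⊙ (rev p) _)

  lincomb≈combination : ∀ {N} (b : Fin N → Path t₀ t₀) c →
    lincomb σ₀ (λ i → F (toList (b i))) c ≈₀ F (toList (combination b c))
  lincomb≈combination {zero}  b c = pow≈power stop (+ 0)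
  lincomb≈combination {suc N} b c = trans′
    (cong· (pow≈power (b zero) (c zero)) (lincomb≈combination (λ i → b (suc i)) (λ i → c (suc i))))
    (++≈⊙ (power (b zero) (c zero)) _)

  listPath : ∀ x xs → Linked Near (x ∷ xs) → LastIs σ₀ (x ∷ xs) →
             Σ (Path (toTree x) t₀) λ p → toList p ≡ map toTree (x ∷ xs)
  listPath x [] _ last = subst (λ t → Σ (Path (toTree x) t) λ p → toList p ≡ toTree x ∷ []) (toTree-cong x σ₀ last) (stop , refl)
  listPath x (y ∷ xs) (e ∷ es) last = let p , eq = listPath y xs es last in
    step (near⇒adj 2≤n {x} {y} e) p , cong (toTree x ∷_) eq

  loop⇒path : ∀ xs → IsLoop σ₀ xs → Σ (Path t₀ t₀) λ p → xs ≈₀ F (toList p)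
  loop⇒path (x ∷ xs) l@(head , last , linked) =
    let p , eq = subst (λ t → Σ (Path t t₀) λ p → toList p ≡ map toTree (x ∷ xs)) (toTree-cong x σ₀ head)
                       (listPath x xs linked last)
    in p , base (grid _ _ l (path-loop p) (subst (λ ts → Pointwise Near (x ∷ xs) (F ts)) (sym eq) (near-trees (x ∷ xs))))
    where
    near-trees : ∀ xs → Pointwise Near xs (F (map toTree xs))
    near-trees []       = []
    near-trees (x ∷ xs) = near-tree x ∷ near-trees xs

  module _ {N : ℕ} (E : Enumeration (n + 2) 4 N) where
    open Enumeration E

    basis : Fin N → Path t₀ t₀
    basis i = generator (at-below i)

    isTurn⇒basis : ∀ {p} → IsTurn p → ∃ λ i → p ≈ basis i
    -- The tree X on 0, ..., a forces a ≥ 1. The subset is therefore stored shifted down by one, as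
    -- a 4-subset of 0, ..., n + 1.
    isTurn⇒basis record { a = zero ; X = X } = ⊥-elim (<⇒≱ (tree-< X) z≤n)
    isTurn⇒basis record { b = zero ; A = A } = ⊥-elim (<⇒≱ (tree-< A) z≤n)
    isTurn⇒basis record { c = zero ; B = B } = ⊥-elim (<⇒≱ (tree-< B) z≤n)
    isTurn⇒basis record { d = zero ; C = C } = ⊥-elim (<⇒≱ (tree-< C) z≤n)
    isTurn⇒basis record { a = suc a ; b = suc b ; c = suc c ; d = suc d ; W = W ; X = X ; A = A ; B = B ; C = C ; eq = eq }
      with position {d ∷ c ∷ b ∷ a ∷ []}
             (tail-≤ W ∷ ≤-pred (tree-< C) ∷ ≤-pred (tree-< B) ∷ ≤-pred (tree-< A) ∷ [])
    ... | i , at-i = i , ≈-trans eq (matches at-i (at-below i))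
      where
      -- Stated for a variable v, because `at i` itself cannot be unified with the vector.
      matches : ∀ {v} → v ≡ d ∷ c ∷ b ∷ a ∷ [] → (β : Below (n + 2) v) → h (plug-adj W (turn X A B C)) ≈ generator β
      matches refl = turn≈generator W X A B C

    InSpan : Path t₀ t₀ → Set
    InSpan p = ∃ λ c → p ≈ combination basis c

    hs-inSpan : ∀ {x y} (p : Path x y) → InSpan (hs p)
    hs-inSpan stop = (λ _ → + 0) , ≈-sym (combination-0 basis)
    hs-inSpan (step e p) with hs-inSpan p
    hs-inSpan (step same p) | c , eq = c , ≈-trans (∙-congʳ (h-same same)) eq
    hs-inSpan (step (fwd r) p) | c , eq with rot-trivial⊎turn r []
    ... | inj₁ trivial = c , ≈-trans (∙-congʳ trivial) eq
    ... | inj₂ t = let i , hr = isTurn⇒basis t in updateAt c i increment ,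
          ≈-trans (∙-cong hr eq) (≈-sym (combination-updateAt basis c i increment (power-increment (basis i) (c i))))
    hs-inSpan (step (bwd r) p) | c , eq with rot-trivial⊎turn r []
    ... | inj₁ trivial = c , ≈-trans (∙-cong (≈-trans (h-inverse (fwd r) (bwd r)) (⁻¹-cong trivial)) eq) ≈-refl
    ... | inj₂ t = let i , hr = isTurn⇒basis t in updateAt c i decrement ,
          ≈-trans (∙-cong (≈-trans (h-inverse (fwd r) (bwd r)) (⁻¹-cong hr)) eq)
                  (≈-sym (combination-updateAt basis c i decrement (power-decrement (basis i) (c i))))

    spanning : ∀ xs → IsLoop σ₀ xs → ∃ λ c → xs ≈₀ lincomb σ₀ (λ i → F (toList (basis i))) c
    spanning xs l =
      let p , xs≈p = loop⇒path xs l
          c , hs≈  = hs-inSpan p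
      in c , trans′ xs≈p (trans′ (lists (≈-trans (loop≈hs p) hs≈)) (sym′ (lincomb≈combination basis c)))

-- Signed flip counts

rot-quad⁻ : ∀ {a b c d i j} {t t′ : Tree i j} → Rot a b c d t t′ → Quad a b c d t′
rot-quad⁻ (rot A B C) = record { ab = inl (inl here) ; bc = inl (inr here) ; cd = inr here ; ad = here }
rot-quad⁻ (inl r) = quad-inl (rot-quad⁻ r)
rot-quad⁻ (inr r) = quad-inr (rot-quad⁻ r)

adj⇒almost : ∀ {i j} {t t′ : Tree i j} → Adj t t′ → AlmostIn t t′
adj⇒almost same x ¬x _ _ = ⊥-elim (¬x x)
adj⇒almost (fwd r) x ¬x y ¬y with rot-keeps r x | rot-keeps r y
... | inj₂ x′ | _ = ⊥-elim (¬x x′)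
... | inj₁ _ | inj₂ y′ = ⊥-elim (¬y y′)
... | inj₁ (refl , refl) | inj₁ (refl , refl) = refl , refl
adj⇒almost (bwd r) x ¬x y ¬y with rot-keeps⁻ r x | rot-keeps⁻ r y
... | inj₂ x′ | _ = ⊥-elim (¬x x′)
... | inj₁ _ | inj₂ y′ = ⊥-elim (¬y y′)
... | inj₁ (refl , refl) | inj₁ (refl , refl) = refl , refl

-- In the subtree on ad the apex must be b or c; any other apex gives a root triangle that crosses
-- ab, bc or cd.
quad-diagonal : ∀ {a b c d i j} {t : Tree i j} → Quad a b c d t → Span a c t ⊎ Span b d t
quad-diagonal {a} {b} {c} {d} {t = t} Q = go t ab bc cd ad
  where
  open Quad Q
  go : ∀ {i j} (t : Tree i j) → Span a b t → Span b c t → Span c d t → Span a d t → Span a c t ⊎ Span b d t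
  go leaf ab bc cd here = ⊥-elim (<⇒≱ (≤-<-trans (span-< ab) (span-< bc)) (<⇒≤ (span-< cd)))
  go (node A B) ab bc cd (inl ad) with go A (span-left (≤-trans (<⇒≤ (<-trans (span-< bc) (span-< cd))) d≤) ab)
                                            (span-left (≤-trans (<⇒≤ (span-< cd)) d≤) bc) (span-left d≤ cd) ad
    where d≤ = span-hi ad
  ... | inj₁ s = inj₁ (inl s)
  ... | inj₂ s = inj₂ (inl s)
  go (node A B) ab bc cd (inr ad) with go B (span-right ≤a ab) (span-right (≤-trans ≤a (<⇒≤ (span-< ab))) bc)
                                            (span-right (≤-trans ≤a (<⇒≤ (<-trans (span-< ab) (span-< bc)))) cd) ad
    where ≤a = span-lo ad
  ... | inj₁ s = inj₁ (inr s)
  ... | inj₂ s = inj₂ (inr s)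
  go (node {k = k} A B) ab bc cd here with <-cmp k b | <-cmp k c
  ... | tri≈ _ refl _ | _ = inj₂ (inr here)
  ... | tri> _ _ _ | tri≈ _ refl _ = inj₁ (inl here)
  ... | tri< k<b _ _ | _ = ⊥-elim (spans-noncrossing ab (inr (here {t = B})) (tree-< A) k<b (<-trans (span-< bc) (span-< cd)))
  ... | tri> _ _ b<k | tri< k<c _ _ = ⊥-elim (spans-noncrossing (inl (here {t = A})) bc (span-< ab) b<k k<c)
  ... | tri> _ _ b<k | tri> _ _ c<k =
        ⊥-elim (spans-noncrossing (inl (here {t = A})) cd (<-trans (span-< ab) (span-< bc)) c<k (tree-< B))

-- Which diagonal of a fixed quadrilateral abcd is present: bd (old), ac (new) or neither.
data State : Set where
  old new none : State

weight : State → State → ℤ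
weight old new = + 1
weight new old = -[1+ 0 ]
weight _   _   = + 0

weight-diag : ∀ s → weight s s ≡ + 0
weight-diag old  = refl
weight-diag new  = refl
weight-diag none = refl

weight-swap : ∀ s s′ → weight s′ s ≡ ℤ.- weight s s′
weight-swap old  old  = refl
weight-swap old  new  = refl
weight-swap old  none = refl
weight-swap new  old  = refl
weight-swap new  new  = refl
weight-swap new  none = refl
weight-swap none old  = refl
weight-swap none new  = refl
weight-swap none none = refl

-- Away from `none` the weight is the difference of a potential, 0 on `old` and 1 on `new`.
weight-telescope : ∀ s s′ s″ → s ≢ none → s′ ≢ none → s″ ≢ none →
                   weight s s′ ℤ.+ weight s′ s″ ≡ weight s s″
weight-telescope none _ _ x _ _ = ⊥-elim (x refl)
weight-telescope _ none _ _ y _ = ⊥-elim (y refl)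
weight-telescope _ _ none _ _ z = ⊥-elim (z refl)
weight-telescope old old old _ _ _ = refl
weight-telescope old old new _ _ _ = refl
weight-telescope old new old _ _ _ = refl
weight-telescope old new new _ _ _ = refl
weight-telescope new old old _ _ _ = refl
weight-telescope new old new _ _ _ = refl
weight-telescope new new old _ _ _ = refl
weight-telescope new new new _ _ _ = refl

-- The weight of a flip with respect to a fixed quadrilateral

module Invariant {a b c d : ℕ} (a<b : a < b) (b<c : b < c) (c<d : c < d) {m : ℕ} where

  private T = Tree 0 m

  -- Testing the two diagonals identifies the flip: if adjacent trees contain bd and ac
  -- respectively, they differ by the flip in abcd (`exchange`).
  state : T → State
  state t with span? {b} {d} t | span? {a} {c} t
  ... | yes _ | _     = old
  ... | no _  | yes _ = new
  ... | no _  | no _  = none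

  state-old⇒ : ∀ t → state t ≡ old → Span b d t
  state-old⇒ t eq with span? {b} {d} t | span? {a} {c} t
  ... | yes s | _     = s
  state-old⇒ t () | no _  | yes _
  state-old⇒ t () | no _  | no _

  state-new⇒ : ∀ t → state t ≡ new → Span a c t
  state-new⇒ t eq with span? {b} {d} t | span? {a} {c} t
  state-new⇒ t () | yes s | _
  ... | no _  | yes s = s
  state-new⇒ t () | no _  | no _

  old⇒state : ∀ t → Span b d t → state t ≡ old
  old⇒state t s with span? {b} {d} t
  ... | yes _ = refl
  ... | no ¬s = ⊥-elim (¬s s)

  new⇒state : ∀ t → Span a c t → state t ≡ new
  new⇒state t s with span? {b} {d} t | span? {a} {c} t
  ... | yes s′ | _    = ⊥-elim (spans-noncrossing s s′ a<b b<c c<d)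
  ... | no _ | yes _  = refl
  ... | no _ | no ¬s  = ⊥-elim (¬s s)

  rot-exchange : ∀ {a′ b′ c′ d′} {t u : T} → Rot a′ b′ c′ d′ t u → Span b d t → Span a c u →
                 a ≡ a′ × b ≡ b′ × c ≡ c′ × d ≡ d′
  rot-exchange r s s′ with rot-keeps r s | rot-keeps⁻ r s′
  ... | inj₂ s″ | _ = ⊥-elim (spans-noncrossing s′ s″ a<b b<c c<d)
  ... | inj₁ _ | inj₂ s″ = ⊥-elim (spans-noncrossing s″ s a<b b<c c<d)
  ... | inj₁ (b≡ , d≡) | inj₁ (a≡ , c≡) = a≡ , b≡ , c≡ , d≡

  -- A `Rot` lowers the first endpoint of the exchanged diagonal, whereas passing from ac to bd
  -- would raise it.
  rot-no-exchange : ∀ {a′ b′ c′ d′} {t u : T} → Rot a′ b′ c′ d′ t u → Span a c t → Span b d u → ⊥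
  rot-no-exchange r s′ s with rot-keeps⁻ r s | rot-keeps r s′
  ... | inj₂ s″ | _ = spans-noncrossing s′ s″ a<b b<c c<d
  ... | inj₁ _ | inj₂ s″ = spans-noncrossing s″ s a<b b<c c<d
  ... | inj₁ (refl , refl) | inj₁ (refl , refl) = <-asym a<b (span-< (Quad.ab (rot-quad r)))

  exchange : ∀ {t u : T} → Adj t u → Span b d t → Span a c u → Rot a b c d t u
  exchange same s s′ = ⊥-elim (spans-noncrossing s′ s a<b b<c c<d)
  exchange (fwd r) s s′ with rot-exchange r s s′
  ... | refl , refl , refl , refl = r
  exchange (bwd r) s s′ = ⊥-elim (rot-no-exchange r s′ s)

  -- A neighbour of a triangulation containing the quadrilateral with one of its diagonals
  -- loses at most one of these spans; losing the diagonal forces the other diagonal.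
  quad-neighbour : ∀ {t v : T} → Quad a b c d t → state t ≢ none → Adj t v → state v ≢ none
  quad-neighbour {t} {v} Q t≢ e v≡ with state t in eq
  ... | none = t≢ refl
  ... | old = diagonal (quad-diagonal record
      { ab = kept ab (λ (x , _) → <⇒≢ a<b x)
      ; bc = kept bc (λ (_ , x) → <⇒≢ c<d x)
      ; cd = kept cd (λ (x , _) → <⇒≢ b<c (sym x))
      ; ad = kept ad (λ (x , _) → <⇒≢ a<b x) })
    where
    open Quad Q
    diagonal : Span a c v ⊎ Span b d v → ⊥
    diagonal (inj₁ s) with trans (sym v≡) (new⇒state v s)
    ... | ()
    diagonal (inj₂ s) with trans (sym v≡) (old⇒state v s)
    ... | ()
    kept : ∀ {p q} → Span p q t → ¬ (p ≡ b × q ≡ d) → Span p q v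
    kept s ≢bd with span? v
    ... | yes s′ = s′
    ... | no ¬s′ = ⊥-elim (≢bd (adj⇒almost e s ¬s′ (state-old⇒ t eq) (λ s → diagonal (inj₂ s))))
  ... | new = diagonal (quad-diagonal record
      { ab = kept ab (λ (_ , x) → <⇒≢ b<c x)
      ; bc = kept bc (λ (x , _) → <⇒≢ a<b (sym x))
      ; cd = kept cd (λ (_ , x) → <⇒≢ c<d (sym x))
      ; ad = kept ad (λ (_ , x) → <⇒≢ c<d (sym x)) })
    where
    open Quad Q
    diagonal : Span a c v ⊎ Span b d v → ⊥
    diagonal (inj₁ s) with trans (sym v≡) (new⇒state v s)
    ... | ()
    diagonal (inj₂ s) with trans (sym v≡) (old⇒state v s)
    ... | ()
    kept : ∀ {p q} → Span p q t → ¬ (p ≡ a × q ≡ c) → Span p q v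
    kept s ≢ac with span? v
    ... | yes s′ = s′
    ... | no ¬s′ = ⊥-elim (≢ac (adj⇒almost e s ¬s′ (state-new⇒ t eq) (λ s → diagonal (inj₁ s))))

  wt : T → T → ℤ
  wt t u = weight (state t) (state u)

  wt-zero⊎quad : ∀ {t u : T} → Adj t u → wt t u ≡ + 0 ⊎
    (Quad a b c d t × Quad a b c d u × state t ≢ none × state u ≢ none)
  wt-zero⊎quad {t} {u} e with state t in eqt | state u in equ
  ... | old | new = let r = exchange e (state-old⇒ t eqt) (state-new⇒ u equ) in
                    inj₂ (rot-quad r , rot-quad⁻ r , (λ ()) , λ ())
  ... | new | old = let r = exchange (adj-sym e) (state-old⇒ u equ) (state-new⇒ t eqt) in
                    inj₂ (rot-quad⁻ r , rot-quad r , (λ ()) , λ ())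
  ... | none | _    = inj₁ refl
  ... | old  | old  = inj₁ refl
  ... | old  | none = inj₁ refl
  ... | new  | new  = inj₁ refl
  ... | new  | none = inj₁ refl

  wt-zeroˡ : ∀ {t u v : T} → Adj t u → Adj t v → state v ≡ none → wt t u ≡ + 0
  wt-zeroˡ e f v≡ with wt-zero⊎quad e
  ... | inj₁ z = z
  ... | inj₂ (Q , _ , t≢ , _) = ⊥-elim (quad-neighbour Q t≢ f v≡)

  wt-zeroʳ : ∀ {t u v : T} → Adj t u → Adj u v → state v ≡ none → wt t u ≡ + 0
  wt-zeroʳ e f v≡ with wt-zero⊎quad e
  ... | inj₁ z = z
  ... | inj₂ (_ , Q , _ , u≢) = ⊥-elim (quad-neighbour Q u≢ f v≡)

  -- If some corner has state `none`, every edge has an end adjacent to that corner, so all four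
  -- weights vanish by `quad-neighbour`. Otherwise both sides telescope to the same potential
  -- difference.
  wt-square : ∀ {t u v w : T} → Adj t u → Adj u w → Adj t v → Adj v w → wt t u ℤ.+ wt u w ≡ wt t v ℤ.+ wt v w
  wt-square {t} {u} {v} {w} tu uw tv vw with none? (state t) | none? (state u) | none? (state v) | none? (state w)
    where
    none? : ∀ s → s ≡ none ⊎ s ≢ none
    none? old  = inj₂ λ ()
    none? new  = inj₂ λ ()
    none? none = inj₁ refl
  ... | inj₁ t≡ | _ | _ | _ = trans
        (cong₂ ℤ._+_ (wt-zeroʳ tu (adj-sym tu) t≡) (wt-zeroˡ uw (adj-sym tu) t≡))
        (sym (cong₂ ℤ._+_ (wt-zeroʳ tv (adj-sym tv) t≡) (wt-zeroˡ vw (adj-sym tv) t≡)))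
  ... | _ | inj₁ u≡ | _ | _ = trans
        (cong₂ ℤ._+_ (wt-zeroˡ tu tu u≡) (wt-zeroʳ uw (adj-sym uw) u≡))
        (sym (cong₂ ℤ._+_ (wt-zeroˡ tv tu u≡) (wt-zeroʳ vw (adj-sym uw) u≡)))
  ... | _ | _ | inj₁ v≡ | _ = trans
        (cong₂ ℤ._+_ (wt-zeroˡ tu tv v≡) (wt-zeroʳ uw (adj-sym vw) v≡))
        (sym (cong₂ ℤ._+_ (wt-zeroˡ tv tv v≡) (wt-zeroʳ vw (adj-sym vw) v≡)))
  ... | _ | _ | _ | inj₁ w≡ = trans
        (cong₂ ℤ._+_ (wt-zeroʳ tu uw w≡) (wt-zeroˡ uw uw w≡))
        (sym (cong₂ ℤ._+_ (wt-zeroʳ tv vw w≡) (wt-zeroˡ vw vw w≡)))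
  ... | inj₂ t≢ | inj₂ u≢ | inj₂ v≢ | inj₂ w≢ = trans
        (weight-telescope (state t) (state u) (state w) t≢ u≢ w≢)
        (sym (weight-telescope (state t) (state v) (state w) t≢ v≢ w≢))

  wt-rot : ∀ {a′ b′ c′ d′} {t u : T} → Rot a′ b′ c′ d′ t u →
           wt t u ≡ + 0 ⊎ (a ≡ a′ × b ≡ b′ × c ≡ c′ × d ≡ d′)
  wt-rot {t = t} {u} r with state t in eqt | state u in equ
  ... | old  | new  = inj₂ (rot-exchange r (state-old⇒ t eqt) (state-new⇒ u equ))
  ... | new  | old  = ⊥-elim (rot-no-exchange r (state-new⇒ t eqt) (state-old⇒ u equ))
  ... | none | _    = inj₁ refl
  ... | old  | old  = inj₁ refl
  ... | old  | none = inj₁ refl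
  ... | new  | new  = inj₁ refl
  ... | new  | none = inj₁ refl

  wt-rot-self : ∀ {t u : T} → Rot a b c d t u → wt t u ≡ + 1
  wt-rot-self {t} {u} r = cong₂ weight (old⇒state t (rot-old r)) (new⇒state u (rot-new r))

  wt-diag : ∀ t → wt t t ≡ + 0
  wt-diag t = weight-diag (state t)

  -- Totals along lists, concatenations and grids

  total : List T → ℤ
  total []           = + 0
  total (t ∷ [])     = + 0
  total (t ∷ u ∷ ts) = wt t u ℤ.+ total (u ∷ ts)

  data Ends : T → T → List T → Set where
    one  : ∀ {t} → Ends t t (t ∷ [])
    more : ∀ {t v w ts} → Ends w v (w ∷ ts) → Ends t v (t ∷ w ∷ ts)

  ends-++ : ∀ {t u v w xs ys} → Ends t u xs → Ends v w ys → Ends t w (xs ++ ys)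
  ends-++ one y@one       = more y
  ends-++ one y@(more _)  = more y
  ends-++ (more x) y      = more (ends-++ x y)

  total-++ : ∀ {t u v xs ys} → Ends t u xs → Ends u v ys → total (xs ++ ys) ≡ total xs ℤ.+ total ys
  total-++ {u = u} one one = cong (ℤ._+ + 0) (wt-diag u)
  total-++ {u = u} {ys = ys} one (more y) = cong (ℤ._+ total ys) (wt-diag u)
  total-++ (more {t} {w = w} {ts = ts} x) y = trans (cong (λ z → wt t w ℤ.+ z) (total-++ x y)) (sym (ℤ.+-assoc (wt t w) (total (w ∷ ts)) _))

  total-repeat : ∀ xs t ys → total (xs ++ t ∷ ys) ≡ total (xs ++ t ∷ t ∷ ys)
  total-repeat [] t ys = sym (trans (cong (ℤ._+ total (t ∷ ys)) (wt-diag t)) (ℤ.+-identityˡ _))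
  total-repeat (x ∷ []) t ys = cong (λ z → wt x t ℤ.+ z) (total-repeat [] t ys)
  total-repeat (x ∷ y ∷ xs) t ys = cong (λ z → wt x y ℤ.+ z) (total-repeat (y ∷ xs) t ys)

  -- The squares between two rows are absorbed one by one with `wt-square`. The first rung remains,
  -- and the last one has weight 0 because both rows end at z.
  total-ladder : ∀ {x y z xs ys} → Linked Adj xs → Linked Adj ys → Pointwise Adj xs ys →
                 Ends x z xs → Ends y z ys → total xs ≡ wt x y ℤ.+ total ys
  total-ladder _ _ _ (one {t}) one = cong (ℤ._+ + 0) (sym (wt-diag t))
  total-ladder (e ∷ es) (f ∷ fs) (g ∷ h ∷ gs) (more {t} {w = x} {ts = xs} p) (more {u} {w = y} {ts = ys} q) = begin
    wt t x ℤ.+ total (x ∷ xs)                 ≡⟨ cong (λ z → wt t x ℤ.+ z) (total-ladder es fs (h ∷ gs) p q) ⟩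
    wt t x ℤ.+ (wt x y ℤ.+ total (y ∷ ys))      ≡⟨ ℤ.+-assoc (wt t x) (wt x y) _ ⟨
    (wt t x ℤ.+ wt x y) ℤ.+ total (y ∷ ys)      ≡⟨ cong (ℤ._+ total (y ∷ ys)) (wt-square e h g f) ⟩
    (wt t u ℤ.+ wt u y) ℤ.+ total (y ∷ ys)      ≡⟨ ℤ.+-assoc (wt t u) (wt u y) _ ⟩
    wt t u ℤ.+ (wt u y ℤ.+ total (y ∷ ys))      ∎
    where
    open ≡-Reasoning
  total-ladder _ _ (_ ∷ ()) one (more _)
  total-ladder _ _ (_ ∷ ()) (more _) one

-- Independence

module Independence (n : ℕ) (2≤n : 2 ≤ n) (σ₀ : Tri n) where
  open Spanning n 2≤n σ₀ public

  linked-trees : ∀ {xs : List (Tri n)} → Linked Near xs → Linked Adj (map toTree xs)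
  linked-trees []                   = []
  linked-trees [-]                  = [-]
  linked-trees (_∷_ {x} {y} e es)   = near⇒adj 2≤n {x} {y} e ∷ linked-trees es

  pointwise-trees : ∀ {xs ys : List (Tri n)} → Pointwise Near xs ys → Pointwise Adj (map toTree xs) (map toTree ys)
  pointwise-trees []                      = []
  pointwise-trees (_∷_ {x} {y} e es)      = near⇒adj 2≤n {x} {y} e ∷ pointwise-trees es

  toTree-F : ∀ ts → map toTree (F ts) ≡ ts
  toTree-F ts = trans (sym (map-∘ ts)) (trans (map-cong to-from ts) (map-id ts))

  -- An element of the dual basis: a homomorphism to ℤ that picks out one generator.
  record Coordinate {v : Vec ℕ 4} (β : Below (n + 2) v) : Set where
    field
      φ       : Path t₀ t₀ → ℤ
      φ-≈     : ∀ {p q} → p ≈ q → φ p ≡ φ q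
      φ-stop  : φ stop ≡ + 0
      φ-⊙     : ∀ p q → φ (p ⊙ q) ≡ φ p ℤ.+ φ q
      φ-rev   : ∀ p → φ (rev p) ≡ ℤ.- φ p
      φ-self  : φ (generator β) ≡ + 1
      φ-other : ∀ {v′} (β′ : Below (n + 2) v′) → v ≢ v′ → φ (generator β′) ≡ + 0

    φ-power-0 : ∀ {p} → φ p ≡ + 0 → ∀ z → φ (power p z) ≡ + 0
    φ-power-0 eq (+ zero) = φ-stop
    φ-power-0 {p} eq (+ suc k) = trans (φ-⊙ p _) (cong₂ ℤ._+_ eq (φ-power-0 eq (+ k)))
    φ-power-0 {p} eq -[1+ zero ] = trans (φ-rev p) (cong ℤ.-_ eq)
    φ-power-0 {p} eq -[1+ suc k ] = trans (φ-⊙ (rev p) _) (cong₂ ℤ._+_ (φ-power-0 {p} eq -[1+ 0 ]) (φ-power-0 eq -[1+ k ]))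

    φ-power-1 : ∀ {p} → φ p ≡ + 1 → ∀ z → φ (power p z) ≡ z
    φ-power-1 eq (+ zero) = φ-stop
    φ-power-1 {p} eq (+ suc k) = trans (φ-⊙ p _) (cong₂ ℤ._+_ eq (φ-power-1 eq (+ k)))
    φ-power-1 {p} eq -[1+ zero ] = trans (φ-rev p) (cong ℤ.-_ eq)
    φ-power-1 {p} eq -[1+ suc k ] = trans (φ-⊙ (rev p) _) (cong₂ ℤ._+_ (φ-power-1 {p} eq -[1+ 0 ]) (φ-power-1 eq -[1+ k ]))

    φ-combination-0 : ∀ {N} (b : Fin N → Path t₀ t₀) c → (∀ j → φ (b j) ≡ + 0) → φ (combination b c) ≡ + 0
    φ-combination-0 {zero} b c zeros = φ-stop
    φ-combination-0 {suc N} b c zeros = trans (φ-⊙ (power (b zero) (c zero)) _)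
      (cong₂ ℤ._+_ (φ-power-0 (zeros zero) (c zero)) (φ-combination-0 (λ j → b (suc j)) (λ j → c (suc j)) λ j → zeros (suc j)))

    φ-combination : ∀ {N} (b : Fin N → Path t₀ t₀) c i → φ (b i) ≡ + 1 → (∀ j → i ≢ j → φ (b j) ≡ + 0) →
                    φ (combination b c) ≡ c i
    φ-combination b c zero one zeros = trans (φ-⊙ (power (b zero) (c zero)) _) (trans
      (cong₂ ℤ._+_ (φ-power-1 one (c zero)) (φ-combination-0 (λ j → b (suc j)) (λ j → c (suc j)) λ j → zeros (suc j) λ ()))
      (ℤ.+-identityʳ (c zero)))
    φ-combination b c (suc i) one zeros = trans (φ-⊙ (power (b zero) (c zero)) _) (trans
      (cong₂ ℤ._+_ (φ-power-0 (zeros zero λ ()) (c zero))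
        (φ-combination (λ j → b (suc j)) (λ j → c (suc j)) i one λ j i≢j → zeros (suc j) λ { refl → i≢j refl }))
      (ℤ.+-identityˡ (c (suc i))))

  plug-turn-rot : ∀ {a b c d} (W : Tail (n + 2) d) (X : Tree 0 a) (A : Tree a b) (B : Tree b c) (C : Tree c d) →
                  Rot a b c d (plug W (node X (node A (node B C)))) (plug W (node X (node (node A B) C)))
  plug-turn-rot W X A B C = plug-rot W (inr (rot A B C))

  module _ {a b c d : ℕ} (d< : d < n + 2) (c<d : c < d) (b<c : b < c) (a<b : a < b) where
    open Invariant {suc a} {suc b} {suc c} {suc d} (s≤s a<b) (s≤s b<c) (s≤s c<d) {n + 2}

    pathTotal : ∀ {x y} → Path x y → ℤ
    pathTotal stop               = + 0
    pathTotal (step {x} {y} e p) = wt x y ℤ.+ pathTotal p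

    total-toList : ∀ {x y} (p : Path x y) → total (toList p) ≡ pathTotal p
    total-toList stop                        = refl
    total-toList (step e stop)               = refl
    total-toList (step {x} {y} e p@(step _ _)) = cong (λ z → wt x y ℤ.+ z) (total-toList p)

    pathTotal-⊙ : ∀ {x y z} (p : Path x y) (q : Path y z) → pathTotal (p ⊙ q) ≡ pathTotal p ℤ.+ pathTotal q
    pathTotal-⊙ stop q = sym (ℤ.+-identityˡ (pathTotal q))
    pathTotal-⊙ (step {x} {y} e p) q = trans (cong (λ z → wt x y ℤ.+ z) (pathTotal-⊙ p q))
      (sym (ℤ.+-assoc (wt x y) (pathTotal p) (pathTotal q)))

    pathTotal-rev : ∀ {x y} (p : Path x y) → pathTotal (rev p) ≡ ℤ.- pathTotal p
    pathTotal-rev stop = refl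
    pathTotal-rev (step {x} {y} e p) = begin
      pathTotal (rev p ⊙ step (adj-sym e) stop)       ≡⟨ pathTotal-⊙ (rev p) _ ⟩
      pathTotal (rev p) ℤ.+ (wt y x ℤ.+ + 0)          ≡⟨ cong₂ ℤ._+_ (pathTotal-rev p)
                                                           (trans (ℤ.+-identityʳ (wt y x)) (weight-swap (state x) (state y))) ⟩
      (ℤ.- pathTotal p) ℤ.+ (ℤ.- wt x y)              ≡⟨ ℤ.+-comm (ℤ.- pathTotal p) (ℤ.- wt x y) ⟩
      (ℤ.- wt x y) ℤ.+ (ℤ.- pathTotal p)              ≡⟨ ℤ.neg-distrib-+ (wt x y) (pathTotal p) ⟨
      ℤ.- (wt x y ℤ.+ pathTotal p)                    ∎
      where open ≡-Reasoning

    -- The counted quadrilateral starts at a + 1, that of a flip at vertex 0 starts at 0. Hence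
    -- canonical paths contribute nothing to a total.
    wt-inc : ∀ {t t′ : T} → Inc t t′ → wt t t′ ≡ + 0
    wt-inc r with wt-rot (proj₂ (proj₂ (proj₂ (inc⇒rot r))))
    ... | inj₁ z = z
    ... | inj₂ (() , _)

    pathTotal-ascend : ∀ {t s : T} (y : Top s) (u : Up t) → pathTotal (ascend y u) ≡ + 0
    pathTotal-ascend y (done x) with top-unique x y
    ... | refl = refl
    pathTotal-ascend y (up r u) = cong₂ ℤ._+_ (wt-inc (next⇒inc r)) (pathTotal-ascend y u)

    pathTotal-rise : ∀ t → pathTotal (rise t) ≡ + 0
    pathTotal-rise t = pathTotal-ascend top-top (climb t)

    pathTotal-rev-rise : ∀ t → pathTotal (rev (rise t)) ≡ + 0
    pathTotal-rev-rise t = trans (pathTotal-rev (rise t)) (cong ℤ.-_ (pathTotal-rise t))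

    pathTotal-h : ∀ {t t′} (e : Adj t t′) → pathTotal (h e) ≡ wt t t′
    pathTotal-h {t} {t′} e = begin
      pathTotal (rise t₀ ⊙ core e ⊙ rev (rise t₀))
        ≡⟨ pathTotal-⊙ (rise t₀) _ ⟩
      pathTotal (rise t₀) ℤ.+ pathTotal (core e ⊙ rev (rise t₀))
        ≡⟨ cong₂ ℤ._+_ (pathTotal-rise t₀) (pathTotal-⊙ (core e) _) ⟩
      + 0 ℤ.+ (pathTotal (core e) ℤ.+ pathTotal (rev (rise t₀)))
        ≡⟨ ℤ.+-identityˡ _ ⟩
      pathTotal (core e) ℤ.+ pathTotal (rev (rise t₀))
        ≡⟨ cong₂ ℤ._+_ (pathTotal-⊙ (rev (rise t)) _) (pathTotal-rev-rise t₀) ⟩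
      (pathTotal (rev (rise t)) ℤ.+ (wt t t′ ℤ.+ pathTotal (rise t′))) ℤ.+ + 0
        ≡⟨ ℤ.+-identityʳ _ ⟩
      pathTotal (rev (rise t)) ℤ.+ (wt t t′ ℤ.+ pathTotal (rise t′))
        ≡⟨ cong₂ ℤ._+_ (pathTotal-rev-rise t) (cong (λ z → wt t t′ ℤ.+ z) (pathTotal-rise t′)) ⟩
      + 0 ℤ.+ (wt t t′ ℤ.+ + 0)
        ≡⟨ trans (ℤ.+-identityˡ _) (ℤ.+-identityʳ _) ⟩
      wt t t′ ∎
      where open ≡-Reasoning

    ends-last : ∀ x xs → LastIs σ₀ (x ∷ xs) → Ends (toTree x) t₀ (map toTree (x ∷ xs))
    ends-last x [] last       = subst (λ t → Ends (toTree x) t (toTree x ∷ [])) (toTree-cong x σ₀ last) one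
    ends-last x (y ∷ xs) last = more (ends-last y xs last)

    loop-ends : ∀ {xs} → IsLoop σ₀ xs → Ends t₀ t₀ (map toTree xs)
    loop-ends {x ∷ xs} (head , last , _) =
      subst (λ t → Ends t t₀ (map toTree (x ∷ xs))) (toTree-cong x σ₀ head) (ends-last x xs last)

    -- The ends are carried along because additivity over concatenation needs them, and `cong·` does
    -- not record that its arguments are loops.
    record SameTotal (xs ys : List (Tri n)) : Set where
      constructor same-total
      field
        endsˡ  : Ends t₀ t₀ (map toTree xs)
        endsʳ  : Ends t₀ t₀ (map toTree ys)
        totals : total (map toTree xs) ≡ total (map toTree ys)

    sameTotal-sym : ∀ {xs ys} → SameTotal xs ys → SameTotal ys xs
    sameTotal-sym (same-total x y e) = same-total y x (sym e)

    sameTotal-trans : ∀ {xs ys zs} → SameTotal xs ys → SameTotal ys zs → SameTotal xs zs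
    sameTotal-trans (same-total x _ e) (same-total _ z f) = same-total x z (trans e f)

    total-++-trees : ∀ xs ys → Ends t₀ t₀ (map toTree xs) → Ends t₀ t₀ (map toTree ys) →
                     total (map toTree (xs ++ ys)) ≡ total (map toTree xs) ℤ.+ total (map toTree ys)
    total-++-trees xs ys x y = trans (cong total (map-++ toTree xs ys)) (total-++ x y)

    ends-++-trees : ∀ xs ys → Ends t₀ t₀ (map toTree xs) → Ends t₀ t₀ (map toTree ys) →
                    Ends t₀ t₀ (map toTree (xs ++ ys))
    ends-++-trees xs ys x y = subst (Ends t₀ t₀) (sym (map-++ toTree xs ys)) (ends-++ x y)

    ≃A⇒sameTotal : ∀ {xs ys} → xs ≃₀ ys → SameTotal xs ys
    ≃A⇒sameTotal (repeat ys x zs l l′) = same-total (loop-ends l) (loop-ends l′) (begin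
        total (map toTree (ys ++ x ∷ zs))                   ≡⟨ cong total (map-++ toTree ys (x ∷ zs)) ⟩
        total (map toTree ys ++ map toTree (x ∷ zs))        ≡⟨ total-repeat (map toTree ys) (toTree x) (map toTree zs) ⟩
        total (map toTree ys ++ map toTree (x ∷ x ∷ zs))    ≡⟨ cong total (map-++ toTree ys (x ∷ x ∷ zs)) ⟨
        total (map toTree (ys ++ x ∷ x ∷ zs))               ∎)
      where open ≡-Reasoning
    ≃A⇒sameTotal (grid xs ys l l′ es) = same-total (loop-ends l) (loop-ends l′) (begin
        total (map toTree xs)                     ≡⟨ total-ladder (linked-trees (proj₂ (proj₂ l))) (linked-trees (proj₂ (proj₂ l′)))
                                                       (pointwise-trees es) (loop-ends l) (loop-ends l′) ⟩
        wt t₀ t₀ ℤ.+ total (map toTree ys)        ≡⟨ cong (ℤ._+ total (map toTree ys)) (wt-diag t₀) ⟩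
        + 0 ℤ.+ total (map toTree ys)             ≡⟨ ℤ.+-identityˡ _ ⟩
        total (map toTree ys)                     ∎)
      where open ≡-Reasoning
    ≃A⇒sameTotal (refl′ xs l)   = same-total (loop-ends l) (loop-ends l) refl
    ≃A⇒sameTotal (sym′ h)       = sameTotal-sym (≃A⇒sameTotal h)
    ≃A⇒sameTotal (trans′ h k)   = sameTotal-trans (≃A⇒sameTotal h) (≃A⇒sameTotal k)

    ≈ab⇒sameTotal : ∀ {xs ys} → xs ≈₀ ys → SameTotal xs ys
    ≈ab⇒sameTotal (base h) = ≃A⇒sameTotal h
    ≈ab⇒sameTotal (comm xs ys l l′) =
      let x = loop-ends l ; y = loop-ends l′ in
      same-total (ends-++-trees xs ys x y) (ends-++-trees ys xs y x)
        (trans (total-++-trees xs ys x y) (trans (ℤ.+-comm (total (map toTree xs)) _) (sym (total-++-trees ys xs y x))))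
    ≈ab⇒sameTotal (cong· {xs} {xs′} {ys} {ys′} h k) with ≈ab⇒sameTotal h | ≈ab⇒sameTotal k
    ... | same-total x x′ e | same-total y y′ f =
      same-total (ends-++-trees xs ys x y) (ends-++-trees xs′ ys′ x′ y′)
        (trans (total-++-trees xs ys x y) (trans (cong₂ ℤ._+_ e f) (sym (total-++-trees xs′ ys′ x′ y′))))
    ≈ab⇒sameTotal (sym′ h)     = sameTotal-sym (≈ab⇒sameTotal h)
    ≈ab⇒sameTotal (trans′ h k) = sameTotal-trans (≈ab⇒sameTotal h) (≈ab⇒sameTotal k)

    pathTotal-≈ : ∀ {p q} → p ≈ q → pathTotal p ≡ pathTotal q
    pathTotal-≈ {p} {q} ⟨ p≈q ⟩ = begin
      pathTotal p                         ≡⟨ total-toList p ⟨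
      total (toList p)                    ≡⟨ cong total (toTree-F (toList p)) ⟨
      total (map toTree (F (toList p)))   ≡⟨ SameTotal.totals (≈ab⇒sameTotal p≈q) ⟩
      total (map toTree (F (toList q)))   ≡⟨ cong total (toTree-F (toList q)) ⟩
      total (toList q)                    ≡⟨ total-toList q ⟩
      pathTotal q                         ∎
      where open ≡-Reasoning

    pathTotal-self : pathTotal (generator (d< ∷ c<d ∷ b<c ∷ a<b ∷ [])) ≡ + 1
    pathTotal-self = trans (pathTotal-h _) (wt-rot-self (plug-turn-rot (fanTail d<) _ _ _ _))

    pathTotal-other : ∀ {v′} (β′ : Below (n + 2) v′) → (d ∷ c ∷ b ∷ a ∷ []) ≢ v′ → pathTotal (generator β′) ≡ + 0
    pathTotal-other (d<′ ∷ c<d′ ∷ b<c′ ∷ a<b′ ∷ []) ≢v′ with wt-rot (plug-turn-rot (fanTail d<′)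
                       (fan z<s) (fan (s≤s a<b′)) (fan (s≤s b<c′)) (fan (s≤s c<d′)))
    ... | inj₁ z = trans (pathTotal-h _) z
    ... | inj₂ (refl , refl , refl , refl) = ⊥-elim (≢v′ refl)

  coordinate : ∀ {v} (β : Below (n + 2) v) → Coordinate β
  coordinate (d< ∷ c<d ∷ b<c ∷ a<b ∷ []) = record
    { φ       = pathTotal d< c<d b<c a<b
    ; φ-≈     = pathTotal-≈ d< c<d b<c a<b
    ; φ-stop  = refl
    ; φ-⊙     = pathTotal-⊙ d< c<d b<c a<b
    ; φ-rev   = pathTotal-rev d< c<d b<c a<b
    ; φ-self  = pathTotal-self d< c<d b<c a<b
    ; φ-other = pathTotal-other d< c<d b<c a<b
    }

  module _ {N : ℕ} (E : Enumeration (n + 2) 4 N) where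
    open Enumeration E

    φ-basis : ∀ i c → Coordinate.φ (coordinate (at-below i)) (combination (basis E) c) ≡ c i
    φ-basis i c = φ-combination (basis E) c i φ-self
      λ j i≢j → φ-other (at-below j) λ eq → i≢j (at-injective i j eq)
      where open Coordinate (coordinate (at-below i))

    independent : ∀ (c c′ : Fin N → ℤ) →
      lincomb σ₀ (λ i → F (toList (basis E i))) c ≈₀ lincomb σ₀ (λ i → F (toList (basis E i))) c′ → ∀ i → c i ≡ c′ i
    independent c c′ eq i = trans (sym (φ-basis i c)) (trans
      (Coordinate.φ-≈ (coordinate (at-below i)) {combination (basis E) c} {combination (basis E) c′}
        ⟨ trans′ (sym′ (lincomb≈combination (basis E) c)) (trans′ eq (lincomb≈combination (basis E) c′)) ⟩)
      (φ-basis i c′))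

open Combinatorics using (_C_)

theorem1p2 : (n : ℕ) → 2 ≤ n → (σ₀ : Tri n) → FreeAbelianOfRank n σ₀ ((n + 2) C 4)
theorem1p2 n 2≤n σ₀ =
    (λ i → F (toList (basis E i))) , (λ i → path-loop (basis E i)) , spanning E , independent E
  where
  open Independence n 2≤n σ₀
  E = enumeration (n + 2) 4
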